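{- Let $\sigma$ be a finite relational signature and $d\in\mathbb{N}$. For every non-empty property $\mathcal{P}\subseteq\mathcal{C}_{\sigma,d}$, $\mathcal{P}$ is FO definable on $\mathcal{C}_{\sigma,d}$ if and only if $\mathcal{P}$ can be obtained as a finite union of properties defined by neighbourhood profiles, i.e. there are $k\in\mathbb{N}$, radii $r_1,\dots,r_k\in\mathbb{N}$ and $r_i$-neighbourhood profiles $\rho_i$ of degree $d$ ($1\le i\le k$) such that $\mathcal{P}=\bigcup_{1\le i\le k}\mathcal{P}_{\rho_i}$.
   Context: A relational signature $\sigma=\{R_1,\dots,R_\ell\}$ is a finite set of relation symbols, each $R_i$ with an arity $\mathrm{ar}(R_i)\geq 1$. A $\sigma$-structure $A$ has a finite universe $U(A)$ (possibly empty) and relations $R_i(A)\subseteq U(A)^{\mathrm{ar}(R_i)}$. The degree of $a\in U(A)$ is the number of tuples (over all relations) in $A$ containing $a$; the degree of $A$ is the maximum degree of its elements. $\mathcal{C}_{\sigma,d}$ is the class of all $\sigma$-structures of degree at most $d$. A property $\mathcal{P}\subseteq\mathcal{C}_{\sigma,d}$ is an isomorphism-closed subset. $\mathcal{P}$ is FO definable on $\mathcal{C}_{\sigma,d}$ if there is a first-order sentence $\varphi$ over $\sigma$ (with equality) such that $\mathcal{P}=\{A\in\mathcal{C}_{\sigma,d} : A\models\varphi\}$. The Gaifman graph of $A$ is the undirected graph on $U(A)$ in which two distinct elements are adjacent iff they occur together in some tuple of some relation of $A$; distance in $A$ is distance in the Gaifman graph. For $r\in\mathbb{N}$ and $a\in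 U(A)$, $N_r^A(a)$ is the set of elements at distance at most $r$ from $a$, and $\mathcal{N}_r^A(a)$ is the substructure of $A$ induced by $N_r^A(a)$. An $r$-ball is a pair $(B,b)$ with $B$ a $\sigma$-structure, $b\in U(B)$ and $U(B)=N_r^B(b)$; two $r$-balls are isomorphic if there is an isomorphism of $\sigma$-structures mapping centre to centre. An $r$-type is an isomorphism class of $r$-balls; $a\in U(A)$ has $r$-type $\tau$ if $(\mathcal{N}_r^A(a),a)\in\tau$. Let $n_{d,r,\sigma}$ be the (finite) number of $r$-types of $\sigma$-structures of degree at most $d$, and fix an enumeration $\tau_{d,r,\sigma}^1,\dots,\tau_{d,r,\sigma}^{n_{d,r,\sigma}}$ of them. The $r$-histogram vector $\overline{v}_{d,r,\sigma}(A)$ of $A\in\mathcal{C}_{\sigma,d}$ has $i$-th entry equal to the number of elements of $A$ of $r$-type $\tau_{d,r,\sigma}^i$. Let $\mathfrak{I}=\{[k,l],[k,\infty) : k\le l\in\mathbb{N}\}$, where $\mathbb{N}$ includes $0$. An $r$-neighbourhood profile of degree $d$ is a function $\rho:\{1,\dots,n_{d,r,\sigma}\}\to\mathfrak{I}$. The property it defines is $\mathcal{P}_\rho=\{A\in\mathcal{C}_{\sigma,d} : (\overline{v}_{d,r,\sigma}(A))_i\in\rho(i)\text{ for all }1\le i\le n_{d,r,\sigma}\}$. -}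

module Defs where

open import Level using (Level; 0ℓ)
open import Data.Bool.Base using (Bool; true; false; T; if_then_else_)
open import Data.Bool.Properties using (T?) renaming (_≟_ to _≟ᵇ_)
open import Data.Empty using (⊥-elim)
open import Data.Fin.Base using (Fin; zero; suc)
open import Data.Fin.Properties using (_≟_; any?; all?; injective⇒≤)
open import Data.List.Base as List
  using (List; []; _∷_; [_]; _++_; length; map; filter; concatMap; allFin; upTo;
         deduplicate; cartesianProductWith)
import Data.List.Properties as List
open import Data.List.Extrema.Nat using (max; xs≤max)
open import Data.List.Membership.Propositional using (_∈_; find; lose)
open import Data.List.Membership.Propositional.Properties
  using (∈-filter⁺; ∈-allFin; ∈-lookup; ∈-cartesianProductWith⁺;
         ∈-concatMap⁺; ∈-++⁺ˡ; ∈-++⁺ʳ; ∈-upTo⁺)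
open import Data.List.Membership.Setoid.Properties using (index-injective)
open import Data.List.Relation.Unary.All as All using ()
import Data.List.Relation.Unary.All.Properties as All
open import Data.List.Relation.Unary.AllPairs using (AllPairs; _∷_)
open import Data.List.Relation.Unary.Any as Any using (Any; here; there)
import Data.List.Relation.Unary.Any.Properties as Any
import Data.List.Relation.Unary.Unique.DecSetoid.Properties as Unique
open import Data.Nat.Base using (ℕ; zero; suc; _≤_; _+_; _*_; _^_; z≤n; s≤s)
open import Data.Nat.ListAction using (sum)
open import Data.Nat.Properties as ℕ using (_≤?_)
open import Data.Product.Base using (∃; ∃-syntax; _×_; _,_; proj₁; proj₂)
open import Data.Sum.Base using (_⊎_; inj₁; inj₂)
open import Data.Vec.Base as Vec using (Vec; []; _∷_; lookup)
import Data.Vec.Properties as Vec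
open import Data.Vec.Functional using (Vector)
open import Data.Vec.Membership.Propositional using () renaming (_∈_ to _∈ᵛ_)
open import Data.Vec.Membership.Propositional.Properties using (∈-toList⁺)
import Data.Vec.Membership.DecPropositional as VecDec
open import Function.Base using (_∘_; const)
open import Function.Bundles using (_↔_; Inverse; mk↔ₛ′)
open import Function.Construct.Identity using (↔-id)
open import Function.Construct.Symmetry using (↔-sym)
open import Function.Construct.Composition using (_↔-∘_)
open import Relation.Binary.Bundles using (DecSetoid)
open import Relation.Binary.PropositionalEquality
  using (_≡_; _≢_; refl; sym; trans; cong; subst)
import Relation.Binary.PropositionalEquality as ≡
open import Relation.Nullary using (¬_; Dec; yes; no; does)
open import Relation.Nullary.Decidable using (map′; _×-dec_; _⊎-dec_; ¬?)
open import Relation.Unary using (Pred; _≐_)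
import Relation.Unary as Unary

record Signature : Set where
  field
    symbols : ℕ
    arity   : Fin symbols → ℕ
    arity≥1 : ∀ i → 1 ≤ arity i

open Signature public

-- Finite structures are taken up to renaming of the universe, which is
-- therefore some Fin n (n = 0 allowed); as finite sets of tuples, relations
-- are given by their Boolean characteristic functions.
record Structure (σ : Signature) : Set where
  field
    size : ℕ
    rel  : (i : Fin (symbols σ)) → Vec (Fin size) (arity σ i) → Bool

  U : Set
  U = Fin size

  Holds : (i : Fin (symbols σ)) → Vec U (arity σ i) → Set
  Holds i t = T (rel i t)

open Structure public

infix 4 _≅_ _≅•_

record _≅_ {σ : Signature} (A B : Structure σ) : Set where
  constructor iso
  field
    bijection : U A ↔ U B
    preserves : ∀ i t → rel A i t ≡ rel B i (Vec.map (Inverse.to bijection) t)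

open _≅_ public

allTuples : (n k : ℕ) → List (Vec (Fin n) k)
allTuples n zero    = [ [] ]
allTuples n (suc k) = cartesianProductWith _∷_ (allFin n) (allTuples n k)

module _ {σ : Signature} (A : Structure σ) where

  Incident : U A → (i : Fin (symbols σ)) → Vec (U A) (arity σ i) → Set
  Incident a i t = Holds A i t × a ∈ᵛ t

  incident? : ∀ a i → Unary.Decidable (Incident a i)
  incident? a i t = T? (rel A i t) ×-dec VecDec._∈?_ _≟_ a t

  incidentTuples : U A → (i : Fin (symbols σ)) → List (Vec (U A) (arity σ i))
  incidentTuples a i = filter (incident? a i) (allTuples (size A) (arity σ i))

  elementDegree : U A → ℕ
  elementDegree a = sum (map (length ∘ incidentTuples a) (allFin (symbols σ)))

  degree : ℕ
  degree = max 0 (map elementDegree (allFin (size A)))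

𝒞 : (σ : Signature) → ℕ → Pred (Structure σ) 0ℓ
𝒞 σ d A = degree A ≤ d

record Property (σ : Signature) (d : ℕ) (p : Level) : Set (Level.suc p) where
  field
    Member     : Pred (Structure σ) p
    bounded    : ∀ {A} → Member A → 𝒞 σ d A
    iso-closed : ∀ {A B} → A ≅ B → Member A → Member B

open Property public

-- Formula σ n has its free variables among n de Bruijn indices; index zero
-- is the variable bound by the innermost quantifier.
data Formula (σ : Signature) (n : ℕ) : Set where
  equal : Fin n → Fin n → Formula σ n
  atom  : (i : Fin (symbols σ)) → Vec (Fin n) (arity σ i) → Formula σ n
  neg   : Formula σ n → Formula σ n
  conj  : Formula σ n → Formula σ n → Formula σ n
  disj  : Formula σ n → Formula σ n → Formula σ n
  exist : Formula σ (suc n) → Formula σ n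
  univ  : Formula σ (suc n) → Formula σ n

Sentence : Signature → Set
Sentence σ = Formula σ 0

module _ {σ : Signature} (A : Structure σ) where

  Satisfies : {n : ℕ} → Vec (U A) n → Formula σ n → Set
  Satisfies v (equal x y) = lookup v x ≡ lookup v y
  Satisfies v (atom i x)  = Holds A i (Vec.map (lookup v) x)
  Satisfies v (neg φ)     = ¬ Satisfies v φ
  Satisfies v (conj φ ψ)  = Satisfies v φ × Satisfies v ψ
  Satisfies v (disj φ ψ)  = Satisfies v φ ⊎ Satisfies v ψ
  Satisfies v (exist φ)   = ∃[ a ] Satisfies (a ∷ v) φ
  Satisfies v (univ φ)    = ∀ a → Satisfies (a ∷ v) φ

infix 4 _⊨_

_⊨_ : {σ : Signature} → Structure σ → Sentence σ → Set
A ⊨ φ = Satisfies A [] φ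

FODefinable : {σ : Signature} {d : ℕ} {p : Level} → Property σ d p → Set p
FODefinable {σ} {d} 𝒫 = ∃[ φ ] Member 𝒫 ≐ (λ A → 𝒞 σ d A × A ⊨ φ)

anyVec? : ∀ {n k} {P : Pred (Vec (Fin n) k) 0ℓ} → Unary.Decidable P → Dec (∃ P)
anyVec? {k = zero}  P? = map′ ([] ,_) (λ { ([] , p) → p }) (P? [])
anyVec? {k = suc k} P? =
  map′ (λ { (x , t , p) → x ∷ t , p }) (λ { (x ∷ t , p) → x , t , p })
       (any? λ x → anyVec? λ t → P? (x ∷ t))

allVec? : ∀ {n k} {P : Pred (Vec (Fin n) k) 0ℓ} → Unary.Decidable P → Dec (∀ t → P t)
allVec? {k = zero}  P? = map′ (λ { p [] → p }) (λ p → p []) (P? [])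
allVec? {k = suc k} P? =
  map′ (λ { p (x ∷ t) → p x t }) (λ p x t → p (x ∷ t))
       (all? λ x → allVec? λ t → P? (x ∷ t))

module _ {σ : Signature} (A : Structure σ) where

  Adjacent : U A → U A → Set
  Adjacent x y = x ≢ y × (∃[ i ] ∃[ t ] Holds A i t × x ∈ᵛ t × y ∈ᵛ t)

  adjacent? : ∀ x y → Dec (Adjacent x y)
  adjacent? x y = ¬? (x ≟ y) ×-dec any? λ i → anyVec? λ t →
    T? (rel A i t) ×-dec VecDec._∈?_ _≟_ x t ×-dec VecDec._∈?_ _≟_ y t

  -- Within r a b: the Gaifman distance from a to b is at most r, i.e. there
  -- is a walk of length at most r from a to b.
  Within : ℕ → U A → U A → Set
  Within zero    a b = a ≡ b
  Within (suc r) a b = Within r a b ⊎ (∃[ c ] Within r a c × Adjacent c b)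

  within? : ∀ r a b → Dec (Within r a b)
  within? zero    a b = a ≟ b
  within? (suc r) a b =
    within? r a b ⊎-dec any? λ c → within? r a c ×-dec adjacent? c b

  within-refl : ∀ r a → Within r a a
  within-refl zero    a = refl
  within-refl (suc r) a = inj₁ (within-refl r a)

  -- N_r(a), listed without repetition.
  N : ℕ → U A → List (U A)
  N r a = filter (within? r a) (allFin (size A))

  centre∈N : ∀ r a → a ∈ N r a
  centre∈N r a = ∈-filter⁺ (within? r a) (∈-allFin a) (within-refl r a)

  -- For repetition-free xs, the substructure of A induced by the elements of
  -- xs; its element j stands for the j-th entry of xs.
  induced : List (U A) → Structure σ
  induced xs = record
    { size = length xs
    ; rel  = λ i t → rel A i (Vec.map (List.lookup xs) t)
    }

record PointedStructure (σ : Signature) : Set where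
  constructor _at_
  field
    structure : Structure σ
    point     : U structure

open PointedStructure public

𝒩 : {σ : Signature} (A : Structure σ) → ℕ → U A → PointedStructure σ
𝒩 A r a = induced A (N A r a) at Any.index (centre∈N A r a)

record _≅•_ {σ : Signature} (𝔸 𝔹 : PointedStructure σ) : Set where
  constructor iso•
  field
    underlying      : structure 𝔸 ≅ structure 𝔹
    preserves-point : Inverse.to (bijection underlying) (point 𝔸) ≡ point 𝔹

open _≅•_ public

IsBall : {σ : Signature} → ℕ → Pred (PointedStructure σ) 0ℓ
IsBall r 𝔹 = ∀ x → Within (structure 𝔹) r (point 𝔹) x

_≅•?_ : {σ : Signature} (𝔸 𝔹 : PointedStructure σ) → Dec (𝔸 ≅• 𝔹)
_≅•?_ {σ} (A at a) (B at b) = map′ fromTables toTables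
  (anyVec? λ p → anyVec? λ q →
    all? (λ y → lookup p (lookup q y) ≟ y) ×-dec
    all? (λ x → lookup q (lookup p x) ≟ x) ×-dec
    all? (λ i → allVec? λ t → rel A i t ≟ᵇ rel B i (Vec.map (lookup p) t)) ×-dec
    lookup p a ≟ b)
  where
  Tables : Set
  Tables = ∃[ p ] ∃[ q ]
    (∀ y → lookup p (lookup q y) ≡ y) ×
    (∀ x → lookup q (lookup p x) ≡ x) ×
    (∀ i t → rel A i t ≡ rel B i (Vec.map (lookup p) t)) ×
    lookup p a ≡ b

  fromTables : Tables → (A at a) ≅• (B at b)
  fromTables (p , q , pq , qp , r , c) = iso• (iso (mk↔ₛ′ (lookup p) (lookup q) pq qp) r) c

  toTables : (A at a) ≅• (B at b) → Tables
  toTables (iso• (iso f r) c) = p , Vec.tabulate from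
    , (λ y → trans (p-to _) (trans (cong to (Vec.lookup∘tabulate from y)) (strictlyInverseˡ y)))
    , (λ x → trans (Vec.lookup∘tabulate from _) (trans (cong from (p-to x)) (strictlyInverseʳ x)))
    , (λ i t → trans (r i t) (cong (rel B i) (Vec.map-cong (sym ∘ p-to) t)))
    , trans (p-to a) c
    where
    open Inverse f
    p = Vec.tabulate to
    p-to : ∀ x → lookup p x ≡ to x
    p-to = Vec.lookup∘tabulate to

-- An enumeration without repetition of the r-types of σ-structures of degree
-- at most d, each type being given by a representative r-ball. One exists for
-- all σ, d and r: see typeEnumeration below.
record TypeEnumeration (σ : Signature) (d r : ℕ) : Set where
  field
    number   : ℕ
    τ        : Fin number → PointedStructure σ
    isBall   : ∀ i → IsBall r (τ i)
    inClass  : ∀ i → 𝒞 σ d (structure (τ i))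
    distinct : ∀ {i j} → τ i ≅• τ j → i ≡ j
    complete : ∀ 𝔹 → IsBall r 𝔹 → 𝒞 σ d (structure 𝔹) → ∃[ i ] 𝔹 ≅• τ i

open TypeEnumeration public

data Interval : Set where
  [_,_]⟨_⟩ : (k l : ℕ) → k ≤ l → Interval
  [_,∞⟩    : ℕ → Interval

infix 4 _∈ᴵ_

_∈ᴵ_ : ℕ → Interval → Set
m ∈ᴵ [ k , l ]⟨ _ ⟩ = k ≤ m × m ≤ l
m ∈ᴵ [ k ,∞⟩        = k ≤ m

module _ {σ : Signature} {d r : ℕ} (E : TypeEnumeration σ d r) where

  HasType : (A : Structure σ) → Fin (number E) → Pred (U A) 0ℓ
  HasType A i a = 𝒩 A r a ≅• τ E i

  hasType? : ∀ A i → Unary.Decidable (HasType A i)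
  hasType? A i a = 𝒩 A r a ≅•? τ E i

  histogram : Structure σ → Vector ℕ (number E)
  histogram A i = length (filter (hasType? A i) (allFin (size A)))

  Profile : Set
  Profile = Fin (number E) → Interval

  𝒫⟨_⟩ : Profile → Pred (Structure σ) 0ℓ
  𝒫⟨ ρ ⟩ A = 𝒞 σ d A × (∀ i → histogram A i ∈ᴵ ρ i)

allTuples-complete : ∀ {n k} (t : Vec (Fin n) k) → t ∈ allTuples n k
allTuples-complete []      = here refl
allTuples-complete (x ∷ t) =
  ∈-cartesianProductWith⁺ _∷_ (∈-allFin x) (allTuples-complete t)

module _ {σ : Signature} where

  ≅•-refl : {𝔸 : PointedStructure σ} → 𝔸 ≅• 𝔸
  ≅•-refl {A at _} = iso• (iso (↔-id _) λ i t → cong (rel A i) (sym (Vec.map-id t))) refl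

  ≅•-sym : {𝔸 𝔹 : PointedStructure σ} → 𝔸 ≅• 𝔹 → 𝔹 ≅• 𝔸
  ≅•-sym {A at _} {B at _} (iso• (iso f r) refl) = iso•
    (iso (↔-sym f) λ i t → trans
      (cong (rel B i) (trans (sym (Vec.map-id t))
        (trans (Vec.map-cong (sym ∘ strictlyInverseˡ) t) (Vec.map-∘ to from t))))
      (sym (r i (Vec.map from t))))
    (strictlyInverseʳ _)
    where open Inverse f

  ≅•-trans : {𝔸 𝔹 ℂ : PointedStructure σ} → 𝔸 ≅• 𝔹 → 𝔹 ≅• ℂ → 𝔸 ≅• ℂ
  ≅•-trans {A at _} {B at _} {C at _} (iso• (iso f r) refl) (iso• (iso g s) refl) = iso•
    (iso (g ↔-∘ f) λ i t → trans (r i t) (trans (s i _)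
      (cong (rel C i) (sym (Vec.map-∘ (Inverse.to g) (Inverse.to f) t)))))
    refl

  ≅•-decSetoid : DecSetoid 0ℓ 0ℓ
  ≅•-decSetoid = record
    { Carrier = PointedStructure σ
    ; _≈_     = _≅•_
    ; isDecEquivalence = record
      { isEquivalence = record
        { refl = ≅•-refl ; sym = ≅•-sym ; trans = ≅•-trans }
      ; _≟_ = _≅•?_
      }
    }

-- A ball of degree at most d and radius r has at most ballBound σ d r elements.

branching : Signature → ℕ → ℕ
branching σ d = d * sum (map (arity σ) (allFin (symbols σ)))

ballBound : Signature → ℕ → ℕ → ℕ
ballBound σ d r = suc (branching σ d) ^ r

∈⇒≤sum : ∀ {A : Set} (f : A → ℕ) {x xs} → x ∈ xs → f x ≤ sum (map f xs)
∈⇒≤sum f (here refl) = ℕ.m≤m+n _ _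
∈⇒≤sum f (there x∈)  = ℕ.≤-trans (∈⇒≤sum f x∈) (ℕ.m≤n+m _ _)

length-concatMap-≤ : ∀ {A B : Set} (f : A → List B) (g : A → ℕ) m →
  (∀ x → length (f x) ≤ g x * m) → ∀ xs →
  length (concatMap f xs) ≤ sum (map g xs) * m
length-concatMap-≤ f g m bound []       = z≤n
length-concatMap-≤ f g m bound (x ∷ xs) = begin
  length (f x ++ concatMap f xs)          ≡⟨ List.length-++ (f x) ⟩
  length (f x) + length (concatMap f xs)  ≤⟨ ℕ.+-mono-≤ (bound x) (length-concatMap-≤ f g m bound xs) ⟩
  g x * m + sum (map g xs) * m            ≡⟨ ℕ.*-distribʳ-+ m (g x) _ ⟨
  (g x + sum (map g xs)) * m              ∎
  where open ℕ.≤-Reasoning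

sum-ones : ∀ {A : Set} (xs : List A) → sum (map (const 1) xs) ≡ length xs
sum-ones []       = refl
sum-ones (_ ∷ xs) = cong suc (sum-ones xs)

length-concatMap-uniform : ∀ {A B : Set} (f : A → List B) m →
  (∀ x → length (f x) ≤ m) → ∀ xs → length (concatMap f xs) ≤ length xs * m
length-concatMap-uniform f m bound xs =
  subst (λ s → length (concatMap f xs) ≤ s * m) (sum-ones xs)
    (length-concatMap-≤ f (const 1) m
      (λ x → ℕ.≤-trans (bound x) (ℕ.≤-reflexive (sym (ℕ.*-identityˡ m)))) xs)

module _ {σ : Signature} (A : Structure σ) where

  neighboursVia : U A → Fin (symbols σ) → List (U A)
  neighboursVia x i = concatMap Vec.toList (incidentTuples A x i)

  neighbours : U A → List (U A)
  neighbours x = concatMap (neighboursVia x) (allFin (symbols σ))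

  reach : ℕ → U A → List (U A)
  reach zero    b = [ b ]
  reach (suc r) b = reach r b ++ concatMap neighbours (reach r b)

  adjacent⇒∈neighbours : ∀ {x y} → Adjacent A x y → y ∈ neighbours x
  adjacent⇒∈neighbours {x} (_ , i , t , h , x∈t , y∈t) =
    ∈-concatMap⁺ (neighboursVia x) (lose (∈-allFin i)
      (∈-concatMap⁺ Vec.toList (lose
        (∈-filter⁺ (incident? A x i) (allTuples-complete t) (h , x∈t))
        (∈-toList⁺ y∈t))))

  within⇒∈reach : ∀ r {b x} → Within A r b x → x ∈ reach r b
  within⇒∈reach zero    refl     = here refl
  within⇒∈reach (suc r) (inj₁ w) = ∈-++⁺ˡ (within⇒∈reach r w)
  within⇒∈reach (suc r) {b} (inj₂ (c , w , adj)) = ∈-++⁺ʳ (reach r b)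
    (∈-concatMap⁺ neighbours (lose (within⇒∈reach r w) (adjacent⇒∈neighbours adj)))

  elementDegree≤degree : ∀ x → elementDegree A x ≤ degree A
  elementDegree≤degree x = All.lookup
    (All.map⁻ (xs≤max 0 (map (elementDegree A) (allFin (size A))))) (∈-allFin x)

  module _ {d : ℕ} (deg : 𝒞 σ d A) where

    length-neighbours : ∀ x → length (neighbours x) ≤ branching σ d
    length-neighbours x = ℕ.≤-trans
      (length-concatMap-≤ (neighboursVia x) (length ∘ incidentTuples A x) m
        (λ i → length-concatMap-uniform Vec.toList m
          (λ t → ℕ.≤-trans (ℕ.≤-reflexive (Vec.length-toList t)) (∈⇒≤sum (arity σ) (∈-allFin i)))
          (incidentTuples A x i))
        (allFin (symbols σ)))
      (ℕ.*-monoˡ-≤ m (ℕ.≤-trans (elementDegree≤degree x) deg))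
      where m = sum (map (arity σ) (allFin (symbols σ)))

    length-reach : ∀ r b → length (reach r b) ≤ ballBound σ d r
    length-reach zero    b = s≤s z≤n
    length-reach (suc r) b = begin
      length (reach r b ++ concatMap neighbours (reach r b))          ≡⟨ List.length-++ (reach r b) ⟩
      length (reach r b) + length (concatMap neighbours (reach r b))  ≤⟨ ℕ.+-monoʳ-≤ _ (length-concatMap-uniform neighbours D length-neighbours (reach r b)) ⟩
      length (reach r b) + length (reach r b) * D                     ≡⟨ ℕ.*-suc (length (reach r b)) D ⟨
      length (reach r b) * suc D                                      ≤⟨ ℕ.*-monoˡ-≤ (suc D) (length-reach r b) ⟩
      ballBound σ d r * suc D                                         ≡⟨ ℕ.*-comm (ballBound σ d r) (suc D) ⟩
      ballBound σ d (suc r)                                           ∎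
      where
      open ℕ.≤-Reasoning
      D = branching σ d

    ball-size : ∀ r b → IsBall r (A at b) → size A ≤ ballBound σ d r
    ball-size r b ball = ℕ.≤-trans
      (injective⇒≤ {f = λ x → Any.index (x∈ x)}
        (λ {x} {y} → index-injective (≡.setoid (U A)) (x∈ x) (x∈ y)))
      (length-reach r b)
      where
      x∈ : ∀ x → x ∈ reach r b
      x∈ x = within⇒∈reach r (ball x)

-- All Boolean functions on xs, and all sections of a family of lists; both up
-- to pointwise equality.

predicates : {A : Set} → (∀ (x y : A) → Dec (x ≡ y)) → List A → List (A → Bool)
predicates _≟ᴬ_ []       = [ const false ]
predicates _≟ᴬ_ (x ∷ xs) = concatMap
  (λ f → map (λ b y → if does (y ≟ᴬ x) then b else f y) (true ∷ false ∷ []))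
  (predicates _≟ᴬ_ xs)

∈-bools : ∀ b → b ∈ true ∷ false ∷ []
∈-bools true  = here refl
∈-bools false = there (here refl)

predicates-complete : ∀ {A : Set} (_≟ᴬ_ : ∀ (x y : A) → Dec (x ≡ y)) xs (f : A → Bool) →
  Any (λ g → ∀ y → y ∈ xs → f y ≡ g y) (predicates _≟ᴬ_ xs)
predicates-complete _≟ᴬ_ []       f = here λ _ ()
predicates-complete _≟ᴬ_ (x ∷ xs) f = Any.concatMap⁺ _
  (Any.map (λ {g} f≡g → Any.map⁺ (Any.map (agree g f≡g) (∈-bools (f x))))
           (predicates-complete _≟ᴬ_ xs f))
  where
  agree : ∀ g → (∀ y → y ∈ xs → f y ≡ g y) → ∀ {b} → f x ≡ b →
          ∀ y → y ∈ x ∷ xs → f y ≡ (if does (y ≟ᴬ x) then b else g y)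
  agree g f≡g fx≡b y y∈ with y ≟ᴬ x
  agree g f≡g fx≡b y y∈         | yes refl = fx≡b
  agree g f≡g fx≡b y (here y≡x) | no y≢x   = ⊥-elim (y≢x y≡x)
  agree g f≡g fx≡b y (there y∈) | no _     = f≡g y y∈

cons : ∀ {n} {X : Fin (suc n) → Set} → X zero → (∀ i → X (suc i)) → ∀ i → X i
cons x f zero    = x
cons x f (suc i) = f i

sections : ∀ {n} {X : Fin n → Set} → (∀ i → List (X i)) → List (∀ i → X i)
sections {zero}  L = [ (λ ()) ]
sections {suc n} L = concatMap (λ x → map (cons x) (sections (L ∘ suc))) (L zero)

sections-complete : ∀ {n} {X : Fin n → Set} (L : ∀ i → List (X i)) {Q : ∀ i → X i → Set} →
  (∀ i → Any (Q i) (L i)) → Any (λ f → ∀ i → Q i (f i)) (sections L)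
sections-complete {zero}  L q = here λ ()
sections-complete {suc n} L q = Any.concatMap⁺ _
  (Any.map (λ q₀ → Any.map⁺ (Any.map (λ { qs zero → q₀ ; qs (suc i) → qs i })
                                     (sections-complete (L ∘ suc) (q ∘ suc))))
           (q zero))

structuresOfSize : (σ : Signature) → ℕ → List (Structure σ)
structuresOfSize σ n = map (λ R → record { size = n ; rel = R })
  (sections λ i → predicates (Vec.≡-dec _≟_) (allTuples n (arity σ i)))

candidates : (σ : Signature) → ℕ → List (PointedStructure σ)
candidates σ m = concatMap
  (λ n → concatMap (λ A → map (A at_) (allFin (size A))) (structuresOfSize σ n))
  (upTo (suc m))

-- Equality of pointed structures, up to pointwise equality of the relations.
data _≋_ {σ : Signature} : PointedStructure σ → PointedStructure σ → Set where
  same : ∀ {n R R′ a} → (∀ i t → R i t ≡ R′ i t) →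
         (record { size = n ; rel = R } at a) ≋ (record { size = n ; rel = R′ } at a)

candidates-complete : ∀ {σ m} (𝔸 : PointedStructure σ) → size (structure 𝔸) ≤ m →
  Any (𝔸 ≋_) (candidates σ m)
candidates-complete {σ} (A at a) n≤m = Any.concatMap⁺ _
  (lose (∈-upTo⁺ (s≤s n≤m)) (Any.concatMap⁺ _ (Any.map⁺
    (Any.map (λ R≡ → Any.map⁺ (Any.map (λ { refl → same R≡ }) (∈-allFin a)))
      (sections-complete _ λ i →
        Any.map (λ f≡g t → f≡g t (allTuples-complete t))
          (predicates-complete (Vec.≡-dec _≟_) (allTuples (size A) (arity σ i)) (rel A i)))))))

module _ {σ : Signature} where

  ≋⇒≅• : {𝔸 𝔹 : PointedStructure σ} → 𝔸 ≋ 𝔹 → 𝔸 ≅• 𝔹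
  ≋⇒≅• (same {R′ = R′} R≡) = iso•
    (iso (↔-id _) λ i t → trans (R≡ i t) (cong (R′ i) (sym (Vec.map-id t)))) refl

  ≋-degree : {𝔸 𝔹 : PointedStructure σ} → 𝔸 ≋ 𝔹 → degree (structure 𝔸) ≡ degree (structure 𝔹)
  ≋-degree (same {n} R≡) = cong (max 0) (List.map-cong (λ a → cong sum (List.map-cong (λ i →
    cong length (List.filter-≐ _ _
      ( (λ { {t} (h , a∈) → subst T (R≡ i t) h , a∈ })
      , (λ { {t} (h , a∈) → subst T (sym (R≡ i t)) h , a∈ }))
      (allTuples n (arity σ i)))) (allFin _))) (allFin n))

  ≋-isBall : ∀ {r} {𝔸 𝔹 : PointedStructure σ} → 𝔸 ≋ 𝔹 → IsBall r 𝔸 → IsBall r 𝔹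
  ≋-isBall {r} (same {n} {R} {R′} R≡) ball x = within r (ball x)
    where
    A B : Structure σ
    A = record { size = n ; rel = R }
    B = record { size = n ; rel = R′ }

    within : ∀ s {a b} → Within A s a b → Within B s a b
    within zero    w        = w
    within (suc s) (inj₁ w) = inj₁ (within s w)
    within (suc s) (inj₂ (c , w , c≢b , i , t , h , ∈∈)) =
      inj₂ (c , within s w , c≢b , i , t , subst T (R≡ i t) h , ∈∈)

AllPairs-lookup : ∀ {A : Set} {R : A → A → Set} {xs} → (∀ {x y} → R x y → R y x) →
  AllPairs (λ x y → ¬ R x y) xs → ∀ i j → R (List.lookup xs i) (List.lookup xs j) → i ≡ j
AllPairs-lookup R-sym (_ ∷ _)   zero    zero    _ = refl
AllPairs-lookup R-sym (x≁ ∷ _)  zero    (suc j) r = ⊥-elim (All.lookup x≁ (∈-lookup j) r)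
AllPairs-lookup R-sym (x≁ ∷ _)  (suc i) zero    r = ⊥-elim (All.lookup x≁ (∈-lookup i) (R-sym r))
AllPairs-lookup R-sym (_ ∷ xs!) (suc i) (suc j) r = cong suc (AllPairs-lookup R-sym xs! i j r)

typeEnumeration : (σ : Signature) (d r : ℕ) → TypeEnumeration σ d r
typeEnumeration σ d r = record
  { number   = length types
  ; τ        = List.lookup types
  ; isBall   = λ i → proj₁ (valid i)
  ; inClass  = λ i → proj₂ (valid i)
  ; distinct = λ {i} {j} → AllPairs-lookup ≅•-sym
                 (Unique.deduplicate-! ≅•-decSetoid good) i j
  ; complete = complete′
  }
  where
  Good : Pred (PointedStructure σ) 0ℓ
  Good 𝔹 = IsBall r 𝔹 × 𝒞 σ d (structure 𝔹)

  good? : Unary.Decidable Good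
  good? (B at b) = all? (within? B r b) ×-dec (degree B ≤? d)

  good types : List (PointedStructure σ)
  good  = filter good? (candidates σ (ballBound σ d r))
  types = deduplicate _≅•?_ good

  valid : ∀ i → Good (List.lookup types i)
  valid i = All.lookup (All.deduplicate⁺ _≅•?_ (All.all-filter good? (candidates σ (ballBound σ d r)))) (∈-lookup i)

  ∈good : ∀ {𝔹} → Good 𝔹 → Any (𝔹 ≋_) (candidates σ (ballBound σ d r)) → Any (𝔹 ≅•_) good
  ∈good (ball , deg) 𝔹≋ with ℂ , ℂ∈ , 𝔹≋ℂ ← find 𝔹≋ =
    lose (∈-filter⁺ good? ℂ∈ (≋-isBall 𝔹≋ℂ ball , subst (_≤ d) (≋-degree 𝔹≋ℂ) deg)) (≋⇒≅• 𝔹≋ℂ)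

  complete′ : ∀ 𝔹 → IsBall r 𝔹 → 𝒞 σ d (structure 𝔹) → ∃[ i ] 𝔹 ≅• List.lookup types i
  complete′ 𝔹 ball deg = Any.index p , Any.lookup-index p
    where
    p : Any (𝔹 ≅•_) types
    p = Any.deduplicate⁺ _≅•?_ (λ f g → ≅•-trans g (≅•-sym f))
      (∈good (ball , deg) (candidates-complete 𝔹
        (ball-size (structure 𝔹) deg r (point 𝔹) ball)))

-- A profile is definable because "x has r-type τ" and "at least k elements have
-- r-type τ" are. Conversely, the truth of a sentence φ in a structure A of degree
-- at most d depends only on the numbers of elements of each R-type, counted up to
-- a threshold t, with R and t computed from φ. It does not suffice to prove this
-- invariance: whether a truncated histogram is realised by some model of φ also
-- has to be decided. So φ is evaluated on the truncated histogram itself: an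
-- element of A near the elements chosen so far is found in a partial isomorphic
-- copy of their neighbourhood, and a far one is replaced by a disjoint copy of its
-- ball, available as soon as its type has more realisations than those near the
-- chosen elements. The latter are at most t - 1 by the degree bound, so the
-- truncated histogram knows whether there are more.

module Submission where

open import Data.Fin.Base using (Fin; zero; suc; _↑ˡ_; _↑ʳ_; splitAt; fromℕ<; inject≤)
open import Data.Fin.Properties
  using (_≟_; any?; all?; injective⇒≤; ↑ˡ-injective; ↑ʳ-injective;
         splitAt-↑ˡ; splitAt-↑ʳ; inject≤-injective)
open import Data.Bool.Base using (Bool; true; false; T)
open import Data.Bool.Properties using (T?)
open import Data.Empty using (⊥; ⊥-elim)
open import Data.List.Base as List using (List; []; _∷_; length; filter; allFin; concatMap; replicate; upTo)
open import Data.List.Extrema.Nat using (max≤v⁺)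
open import Data.List.Membership.Propositional using (_∈_; find; lose)
open import Data.List.Membership.Propositional.Properties
  using (∈-filter⁺; ∈-filter⁻; ∈-allFin; ∈-lookup; ∈-concatMap⁺; ∈-upTo⁺)
open import Data.List.Membership.Setoid.Properties using (index-injective)
import Data.List.Properties as List
import Data.List.Relation.Unary.Any as Any
import Data.List.Relation.Unary.Any.Properties as Any
import Data.List.Relation.Unary.All as All
open import Data.List.Relation.Unary.All.Properties using (map⁺; replicate⁺)
open import Data.List.Relation.Unary.Any using (Any)
open import Data.List.Relation.Unary.All using (All)
open import Data.List.Relation.Unary.AllPairs as AllPairs using ([]; _∷_)
import Data.List.Relation.Unary.AllPairs.Properties as AllPairs
open import Data.List.Relation.Binary.Disjoint.Propositional using (Disjoint)
open import Data.List.Relation.Unary.Unique.Propositional using (Unique)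
open import Data.List.Relation.Unary.Unique.Propositional.Properties
  using (allFin⁺; filter⁺; concat⁺; cartesianProductWith⁺)
open import Data.Nat.Base using (ℕ; zero; suc; _≤_; _+_; _*_; _⊔_; _⊓_; z≤n; s≤s)
open import Data.Nat.ListAction using (sum)
import Data.Nat.Properties as ℕ
open import Data.Product.Base using (Σ-syntax; ∃-syntax; _×_; _,_; proj₁; proj₂)
open import Data.Sum.Base using (_⊎_; inj₁; inj₂; fromInj₁; fromInj₂)
open import Data.Vec.Base as Vec using (Vec; []; _∷_; lookup; tabulate)
import Data.Vec.Properties as Vec
open import Data.Vec.Membership.Propositional using () renaming (_∈_ to _∈ᵛ_)
open import Data.Vec.Membership.Propositional.Properties
  using (∈-toList⁺) renaming (∈-lookup to ∈ᵛ-lookup; ∈-map⁺ to ∈-map⁺ᵛ)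
import Data.Vec.Relation.Unary.Any as AnyVec
import Data.Vec.Relation.Unary.Any.Properties as AnyVec
open import Data.Product.Function.NonDependent.Propositional using (_×-⇔_)
open import Data.Sum.Function.Propositional using (_⊎-⇔_)
open import Function.Base using (_∘_; flip; id; case_of_)
open import Function.Construct.Composition using (_⇔-∘_)
open import Function.Bundles using (_⇔_; mk⇔; Equivalence; Inverse; mk↔ₛ′)
open import Level using (Level)
open import Relation.Binary.PropositionalEquality
  using (_≡_; _≢_; refl; sym; trans; cong; cong₂; subst; subst₂; setoid)
open import Relation.Nullary using (¬_; Dec; yes; no)
open import Relation.Nullary.Decidable using (_×-dec_; _⊎-dec_; _→-dec_; ¬?; decidable-stable; ⌊_⌋; toWitness; fromWitness; map′)
open import Relation.Unary using (Decidable; _≐_; Satisfiable; ⋃)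
open import Defs

open Equivalence using (to; from)

-- Counting in finite lists and truncated equality

-- The pigeonhole principle: sending each position in `xs` to the position of its partner is
-- injective. `R` is a relation, so the graph of a partial isomorphism can be used as it stands.
length-≤ : {X Y : Set} {xs : List X} {ys : List Y} (R : X → Y → Set) → Unique xs →
  (∀ {x x′ y} → R x y → R x′ y → x ≡ x′) →
  (∀ {x} → x ∈ xs → ∃[ y ] y ∈ ys × R x y) → length xs ≤ length ys
length-≤ {xs = xs} R xs! R-injective partner =
  injective⇒≤ {f = λ i → Any.index (proj₁ (proj₂ (partner (∈-lookup {xs = xs} i))))} injective
  where
  injective : ∀ {i j} →
    Any.index (proj₁ (proj₂ (partner (∈-lookup {xs = xs} i)))) ≡
    Any.index (proj₁ (proj₂ (partner (∈-lookup {xs = xs} j)))) → i ≡ j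
  injective {i} {j} eq with partner (∈-lookup {xs = xs} i) | partner (∈-lookup {xs = xs} j)
  ... | y , y∈ , r | y′ , y′∈ , r′ with index-injective (setoid _) y∈ y′∈ eq
  ... | refl = AllPairs-lookup sym xs! i j (R-injective r r′)

module _ {m n : ℕ} {P : Fin m → Set} {Q : Fin n → Set} (P? : Decidable P) (Q? : Decidable Q) where

  count-≤ : (R : Fin m → Fin n → Set) →
    (∀ {x x′ y} → R x y → R x′ y → x ≡ x′) → (∀ {x} → P x → ∃[ y ] Q y × R x y) →
    length (filter P? (allFin m)) ≤ length (filter Q? (allFin n))
  count-≤ R R-injective partner = length-≤ R (filter⁺ P? (allFin⁺ m)) R-injective λ x∈ →
    let y , q , r = partner (proj₂ (∈-filter⁻ P? {xs = allFin m} x∈)) in y , ∈-filter⁺ Q? (∈-allFin y) q , r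

lookup-ext : {X : Set} {n : ℕ} {xs ys : Vec X n} → (∀ i → lookup xs i ≡ lookup ys i) → xs ≡ ys
lookup-ext {xs = xs} {ys} eq =
  trans (sym (Vec.tabulate∘lookup xs)) (trans (Vec.tabulate-cong eq) (Vec.tabulate∘lookup ys))

tabulate-related : {X Y : Set} (Z : X → Y → Set) {n : ℕ} (s : Vec X n)
  (partner : ∀ k → ∃[ y ] Z (lookup s k) y) →
  ∀ k → Z (lookup s k) (lookup (tabulate (proj₁ ∘ partner)) k)
tabulate-related Z s partner k =
  subst (Z (lookup s k)) (sym (Vec.lookup∘tabulate _ k)) (proj₂ (partner k))

nonempty : {X : Set} {xs : List X} {m : ℕ} → suc m ≤ length xs → ∃[ x ] x ∈ xs
nonempty {xs = x ∷ _} _ = x , Any.here refl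

∈-map-lookup : {X Y : Set} {f : X → Y} {n : ℕ} {z : Y} {s : Vec X n} →
  z ∈ᵛ Vec.map f s → ∃[ x ] x ∈ᵛ s × f x ≡ z
∈-map-lookup {s = s} z∈ = lookup s k , ∈ᵛ-lookup k s ,
  trans (sym (Vec.lookup-map k _ s)) (sym (AnyVec.lookup-index z∈))
  where k = AnyVec.index z∈

sum-mono : {X : Set} {f g : X → ℕ} → (∀ x → f x ≤ g x) → ∀ xs → sum (List.map f xs) ≤ sum (List.map g xs)
sum-mono f≤g []       = z≤n
sum-mono f≤g (x ∷ xs) = ℕ.+-mono-≤ (f≤g x) (sum-mono f≤g xs)

allTuples-unique : ∀ n k → Unique (allTuples n k)
allTuples-unique n zero    = All.[] ∷ []
allTuples-unique n (suc k) = cartesianProductWith⁺ _∷_ Vec.∷-injective (allFin⁺ n) (allTuples-unique n k)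

infix 4 _≃[_]_

-- Equality of the truncations of `a` and `b` at `t`: counts of at least `t` are not told apart.
_≃[_]_ : ℕ → ℕ → ℕ → Set
a ≃[ t ] b = a ≡ b ⊎ (t ≤ a × t ≤ b)

≃-sym : ∀ {a b t} → a ≃[ t ] b → b ≃[ t ] a
≃-sym (inj₁ e)       = inj₁ (sym e)
≃-sym (inj₂ (p , q)) = inj₂ (q , p)

-- What a truncated count still knows: lower bounds up to `t`. The quantifier steps consult it in
-- this way only.
≃-transfer : ∀ {a b t m} → a ≃[ t ] b → m ≤ t → m ≤ a → m ≤ b
≃-transfer (inj₁ refl)    _   m≤a = m≤a
≃-transfer (inj₂ (_ , q)) m≤t _   = ℕ.≤-trans m≤t q

≃-+ : ∀ {a b c d t} → a ≃[ t ] b → c ≃[ t ] d → a + c ≃[ t ] b + d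
≃-+ (inj₂ (p , q)) _ = inj₂ (ℕ.m≤n⇒m≤n+o _ p , ℕ.m≤n⇒m≤n+o _ q)
≃-+ {a} {b} (inj₁ _) (inj₂ (p , q)) = inj₂ (ℕ.m≤n⇒m≤o+n a p , ℕ.m≤n⇒m≤o+n b q)
≃-+ (inj₁ refl) (inj₁ refl) = inj₁ refl

-- Truncated equality is compatible with addition, so it may be checked block by block. The blocks
-- will be the types.
≃-concatMap : {X Y I : Set} {P : X → Set} {Q : Y → Set} (P? : Decidable P) (Q? : Decidable Q) {t : ℕ}
  (f : I → List X) (g : I → List Y) →
  (∀ i → length (filter P? (f i)) ≃[ t ] length (filter Q? (g i))) → ∀ is →
  length (filter P? (concatMap f is)) ≃[ t ] length (filter Q? (concatMap g is))
≃-concatMap P? Q? f g eq []       = inj₁ refl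
≃-concatMap P? Q? {t} f g eq (i ∷ is) = subst₂ _≃[ t ]_ (sym (split P? (f i) _)) (sym (split Q? (g i) _))
  (≃-+ (eq i) (≃-concatMap P? Q? f g eq is))
  where
  split : {X : Set} {P : X → Set} (P? : Decidable P) → ∀ xs ys →
    length (filter P? (xs List.++ ys)) ≡ length (filter P? xs) + length (filter P? ys)
  split P? xs ys = trans (cong length (List.filter-++ P? xs ys)) (List.length-++ (filter P? xs))

-- Partial isomorphisms and locality

-- A partial isomorphism is given by its graph, so that inverses and unions
-- need no decisions and empty universes no special treatment.
record IsPartialIso {σ : Signature} (A B : Structure σ) (Z : U A → U B → Set) : Set where
  field
    functional : ∀ {x y y′} → Z x y → Z x y′ → y ≡ y′
    injective  : ∀ {x x′ y} → Z x y → Z x′ y → x ≡ x′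
    preserve   : ∀ i {s t} → (∀ k → Z (lookup s k) (lookup t k)) → Holds A i s → Holds B i t
    reflect    : ∀ i {s t} → (∀ k → Z (lookup s k) (lookup t k)) → Holds B i t → Holds A i s

Near : {σ : Signature} {n : ℕ} (A : Structure σ) → ℕ → Vec (U A) n → U A → Set
Near A r v x = ∃[ i ] Within A r (lookup v i) x

near? : {σ : Signature} {n : ℕ} (A : Structure σ) (r : ℕ) (v : Vec (U A) n) → Decidable (Near A r v)
near? A r v x = any? λ i → within? A r (lookup v i) x

-- `Z` has to cover the `r`-neighbourhoods of both tuples but may be larger. Hence shrinking `r`, or
-- choosing a further element whose neighbourhood is already covered, leaves `Z` unchanged.
record Match {σ : Signature} {n : ℕ} (r : ℕ)
  (A : Structure σ) (v : Vec (U A) n) (B : Structure σ) (w : Vec (U B) n) : Set₁ where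
  field
    Z            : U A → U B → Set
    isPartialIso : IsPartialIso A B Z
    points       : ∀ i → Z (lookup v i) (lookup w i)
    domain       : ∀ {x} → Near A r v x → ∃[ y ] Z x y
    range        : ∀ {y} → Near B r w y → ∃[ x ] Z x y
  open IsPartialIso isPartialIso public

module _ {σ : Signature} where

  match-sym : ∀ {n r A v B w} → Match {σ} {n} r A v B w → Match r B w A v
  match-sym M = record
    { Z            = flip Z
    ; isPartialIso = record
      { functional = injective ; injective = functional
      ; preserve = λ i z → reflect i z ; reflect = λ i z → preserve i z }
    ; points       = points
    ; domain       = range
    ; range        = domain
    }
    where open Match M

  within-mono : ∀ (A : Structure σ) {r s x y} → r ≤ s → Within A r x y → Within A s x y
  within-mono A {s = zero}  z≤n     w        = w
  within-mono A {s = suc s} z≤n     w        = inj₁ (within-mono A {s = s} z≤n w)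
  within-mono A             (s≤s l) (inj₁ w) = inj₁ (within-mono A l w)
  within-mono A             (s≤s l) (inj₂ (z , w , adj)) = inj₂ (z , within-mono A l w , adj)

  within-trans : ∀ (A : Structure σ) {r x y z} s → Within A r x y → Within A s y z → Within A (s + r) x z
  within-trans A zero    w refl      = w
  within-trans A (suc s) w (inj₁ w′) = inj₁ (within-trans A s w w′)
  within-trans A (suc s) w (inj₂ (u , w′ , adj)) = inj₂ (u , within-trans A s w w′ , adj)

  adjacent-sym : ∀ (A : Structure σ) {x y} → Adjacent A x y → Adjacent A y x
  adjacent-sym A (x≢y , i , t , h , x∈ , y∈) = x≢y ∘ sym , i , t , h , y∈ , x∈

  within-sym : ∀ (A : Structure σ) {x y} r → Within A r x y → Within A r y x
  within-sym A zero    refl     = refl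
  within-sym A (suc r) (inj₁ w) = inj₁ (within-sym A r w)
  within-sym A {x} {y} (suc r) (inj₂ (z , w , adj)) =
    -- Reversed, the last edge comes first as a walk of length 1, so concatenation gives the bound
    -- `r + 1` instead of `suc r`.
    subst (λ s → Within A s y x) (ℕ.+-comm r 1)
      (within-trans A r (inj₂ (y , refl , adjacent-sym A adj)) (within-sym A r w))

  within-tuple : ∀ (A : Structure σ) {r x y z i t} → Within A r x y →
    Holds A i t → y ∈ᵛ t → z ∈ᵛ t → Within A (suc r) x z
  within-tuple A {y = y} {z} w h y∈ z∈ with y ≟ z
  ... | yes refl = inj₁ w
  ... | no y≢z   = inj₂ (_ , w , y≢z , _ , _ , h , y∈ , z∈)

  near-mono : ∀ {n} {A : Structure σ} {v : Vec (U A) n} {r s x} → r ≤ s → Near A r v x → Near A s v x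
  near-mono {A = A} l (i , w) = i , within-mono A l w

  match-mono : ∀ {n r s A v B w} → r ≤ s → Match {σ} {n} s A v B w → Match r A v B w
  match-mono {A = A} {v} {B} {w} l M = record
    { Z = Z ; isPartialIso = isPartialIso ; points = points
    ; domain = domain ∘ near-mono {A = A} {v} l ; range = range ∘ near-mono {A = B} {w} l }
    where open Match M

  module _ {n r A v B w} (M : Match {σ} {n} r A v B w) where
    open Match M

    -- Induction along the walk. The tuple behind the last edge lies entirely within distance
    -- `suc s` of the chosen element, hence in the domain of `Z`, so it can be carried over to `B`
    -- as a whole.
    match-within : ∀ s {i x y} → s ≤ r → Within A s (lookup v i) x → Z x y → Within B s (lookup w i) y
    match-within zero    _   refl     zxy = functional (points _) zxy
    match-within (suc s) s<r (inj₁ p) zxy = inj₁ (match-within s (ℕ.<⇒≤ s<r) p zxy)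
    match-within (suc s) {i} {x} {y} s<r (inj₂ (c , p , c≢x , j , t , h , c∈ , x∈)) zxy =
      inj₂ (c′ , match-within s (ℕ.<⇒≤ s<r) p zcc′
              , (λ { refl → c≢x (injective zcc′ zxy) })
              , j , u , preserve j (tabulate-related Z t partner) h
              , image zcc′ c∈ , image zxy x∈)
      where
      partner : ∀ k → ∃[ y ] Z (lookup t k) y
      partner k = domain (i , within-mono A s<r (within-tuple A p h c∈ (∈ᵛ-lookup k t)))

      u : Vec (U B) _
      u = tabulate (proj₁ ∘ partner)

      c′ = proj₁ (domain (i , within-mono A (ℕ.<⇒≤ s<r) p))
      zcc′ = proj₂ (domain (i , within-mono A (ℕ.<⇒≤ s<r) p))

      image : ∀ {a b} → Z a b → a ∈ᵛ t → b ∈ᵛ u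
      image {a} {b} zab a∈ = subst (_∈ᵛ u) eq (∈ᵛ-lookup k u)
        where
        k = AnyVec.index a∈
        eq : lookup u k ≡ b
        eq = trans (Vec.lookup∘tabulate _ k)
          (functional (subst (λ a → Z a (proj₁ (partner k))) (sym (AnyVec.lookup-index a∈)) (proj₂ (partner k))) zab)

    match-near : ∀ {s x y} → s ≤ r → Near A s v x → Z x y → Near B s w y
    match-near s≤r (i , p) zxy = i , match-within _ s≤r p zxy

  -- Both 𝒩 A r a and an r-ball itself are charts, so that types of elements and
  -- their representative balls are compared by the same lemma.
  record Chart (r : ℕ) (A : Structure σ) (a : U A) (𝔸 : PointedStructure σ) : Set where
    field
      embed     : U (structure 𝔸) → U A
      injective : ∀ {x y} → embed x ≡ embed y → x ≡ y
      strong    : ∀ i t → rel (structure 𝔸) i t ≡ rel A i (Vec.map embed t)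
      pointed   : embed (point 𝔸) ≡ a
      within    : ∀ x → Within A r a (embed x)
      covers    : ∀ {y} → Within A r a y → ∃[ x ] embed x ≡ y

  𝒩-chart : ∀ r (A : Structure σ) a → Chart r A a (𝒩 A r a)
  𝒩-chart r A a = record
    { embed     = List.lookup (N A r a)
    ; injective = AllPairs-lookup sym (filter⁺ (within? A r a) (allFin⁺ (size A))) _ _
    ; strong    = λ _ _ → refl
    ; pointed   = sym (Any.lookup-index (centre∈N A r a))
    ; within    = λ x → proj₂ (∈-filter⁻ (within? A r a) {xs = allFin (size A)} (∈-lookup x))
    ; covers    = λ {y} w → let y∈ = ∈-filter⁺ (within? A r a) (∈-allFin y) w in
                  Any.index y∈ , sym (Any.lookup-index y∈)
    }

  ball-chart : ∀ {r} {𝔹 : PointedStructure σ} → IsBall r 𝔹 → Chart r (structure 𝔹) (point 𝔹) 𝔹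
  ball-chart {𝔹 = B at _} ball = record
    { embed     = id
    ; injective = id
    ; strong    = λ i t → cong (rel B i) (sym (Vec.map-id t))
    ; pointed   = refl
    ; within    = ball
    ; covers    = λ {y} _ → y , refl
    }

  module _ {r A a B b 𝔸 𝔹} (C : Chart r A a 𝔸) (D : Chart r B b 𝔹) where
    private
      module C = Chart C
      module D = Chart D

    charts⇒match : 𝔸 ≅• 𝔹 → Match r A (a ∷ []) B (b ∷ [])
    charts⇒match (iso• (iso f f-rel) f-point) = record
      { Z = Z
      ; isPartialIso = record
        { functional = λ { (x , refl , refl) (x′ , ex , refl) → cong (D.embed ∘ f.to) (C.injective (sym ex)) }
        ; injective  = λ { (x , refl , refl) (x′ , refl , fx) →
                           cong C.embed (trans (sym (f.strictlyInverseʳ x))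
                             (trans (cong f.from (D.injective (sym fx))) (f.strictlyInverseʳ x′))) }
        ; preserve   = λ i z → subst T (transfer i z)
        ; reflect    = λ i z → subst T (sym (transfer i z))
        }
      ; points = λ { zero → point 𝔸 , C.pointed , trans (cong D.embed f-point) D.pointed }
      ; domain = λ { (zero , w) → let x , ex = C.covers w in D.embed (f.to x) , x , ex , refl }
      ; range  = λ { (zero , w) → let y , ey = D.covers w in
                     C.embed (f.from y) , f.from y , refl , trans (cong D.embed (f.strictlyInverseˡ y)) ey }
      }
      where
      module f = Inverse f
      Z : U A → U B → Set
      Z x y = ∃[ u ] C.embed u ≡ x × D.embed (f.to u) ≡ y

      transfer : ∀ i {s t} → (∀ k → Z (lookup s k) (lookup t k)) → rel A i s ≡ rel B i t
      transfer i {s} {t} z = trans (cong (rel A i) (sym es)) (trans (sym (C.strong i u))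
        (trans (f-rel i u) (trans (D.strong i (Vec.map f.to u)) (cong (rel B i) et))))
        where
        u = tabulate (proj₁ ∘ z)
        es : Vec.map C.embed u ≡ s
        es = lookup-ext λ k → trans (Vec.lookup-map k C.embed u)
          (trans (cong C.embed (Vec.lookup∘tabulate _ k)) (proj₁ (proj₂ (z k))))
        et : Vec.map D.embed (Vec.map f.to u) ≡ t
        et = lookup-ext λ k → trans (Vec.lookup-map k D.embed (Vec.map f.to u))
          (trans (cong D.embed (trans (Vec.lookup-map k f.to u) (cong f.to (Vec.lookup∘tabulate _ k))))
            (proj₂ (proj₂ (z k))))

    -- By `match-within`, a partner of an element of one `r`-neighbourhood lies in the other, so `Z`
    -- restricts to a bijection between the charts.
    match⇒charts : Match r A (a ∷ []) B (b ∷ []) → 𝔸 ≅• 𝔹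
    match⇒charts M = iso•
      (iso (mk↔ₛ′ (proj₁ ∘ forth) (proj₁ ∘ back)
        (λ y → D.injective (functional (proj₂ (forth _)) (proj₂ (back y))))
        (λ x → C.injective (injective (proj₂ (back _)) (proj₂ (forth x)))))
        λ i t → trans (C.strong i t) (trans (≡-of i (related t)) (sym (D.strong i _))))
      -- Both the image of the centre and `b` are partners of `a`, so functionality identifies them.
      (D.injective (functional (subst (λ x → Z x (D.embed (proj₁ (forth (point 𝔸))))) C.pointed (proj₂ (forth (point 𝔸))))
        (subst (Z a) (sym D.pointed) (points zero))))
      where
      open Match M
      forth : ∀ x → ∃[ y ] Z (C.embed x) (D.embed y)
      forth x = let _ , z = domain (zero , C.within x)
                    y , ey = D.covers (match-within M r {zero} ℕ.≤-refl (C.within x) z)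
                in y , subst (Z _) (sym ey) z

      back : ∀ y → ∃[ x ] Z (C.embed x) (D.embed y)
      back y = let _ , z = range (zero , D.within y)
                   x , ex = C.covers (match-within (match-sym M) r {zero} ℕ.≤-refl (D.within y) z)
               in x , subst (λ x → Z x _) (sym ex) z

      related : ∀ {n} (t : Vec _ n) k →
        Z (lookup (Vec.map C.embed t) k) (lookup (Vec.map D.embed (Vec.map (proj₁ ∘ forth) t)) k)
      related (x ∷ t) zero    = proj₂ (forth x)
      related (x ∷ t) (suc k) = related t k

      ≡-of : ∀ i {s t} → (∀ k → Z (lookup s k) (lookup t k)) → rel A i s ≡ rel B i t
      ≡-of i {s} {t} z with rel A i s | rel B i t | preserve i {s} {t} z | reflect i {s} {t} z
      ... | true  | true  | _ | _ = refl
      ... | false | false | _ | _ = refl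
      ... | true  | false | p | _ = ⊥-elim (p _)
      ... | false | true  | _ | p = ⊥-elim (p _)

  -- Disjoint unions

  empty : Structure σ
  empty = record { size = 0 ; rel = λ _ _ → false }

  infixl 6 _⊕_

  left : (B C : Structure σ) → U B → Fin (size B + size C)
  left B C x = x ↑ˡ size C

  right : (B C : Structure σ) → U C → Fin (size B + size C)
  right B C y = size B ↑ʳ y

  UnionHolds : ∀ B C i → Vec (Fin (size B + size C)) (arity σ i) → Set
  UnionHolds B C i t = (∃[ s ] Holds B i s × Vec.map (left B C) s ≡ t)
                     ⊎ (∃[ s ] Holds C i s × Vec.map (right B C) s ≡ t)

  unionHolds? : ∀ B C i → Decidable (UnionHolds B C i)
  unionHolds? B C i t =
    anyVec? (λ s → T? (rel B i s) ×-dec Vec.≡-dec _≟_ (Vec.map (left B C) s) t) ⊎-dec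
    anyVec? (λ s → T? (rel C i s) ×-dec Vec.≡-dec _≟_ (Vec.map (right B C) s) t)

  _⊕_ : Structure σ → Structure σ → Structure σ
  B ⊕ C = record { size = size B + size C ; rel = λ i t → ⌊ unionHolds? B C i t ⌋ }

  -- The closure hypothesis says that a tuple meeting the image of `f` comes from `D`. A walk that
  -- starts in the image therefore never leaves it and is traced by tuples of `D`.
  within-summand : ∀ (A D : Structure σ) (f : U D → U A) → (∀ {x y} → f x ≡ f y → x ≡ y) →
    (∀ i {t x} → Holds A i t → f x ∈ᵛ t → ∃[ s ] Holds D i s × Vec.map f s ≡ t) →
    ∀ r {x z} → Within A r (f x) z → ∃[ y ] f y ≡ z × Within D r x y
  within-summand A D f f-inj closed zero    refl     = _ , refl , refl
  within-summand A D f f-inj closed (suc r) (inj₁ w) =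
    let y , e , w′ = within-summand A D f f-inj closed r w in y , e , inj₁ w′
  within-summand A D f f-inj closed (suc r) (inj₂ (c , w , _ , i , t , h , c∈ , z∈))
    with within-summand A D f f-inj closed r w
  ... | y , refl , w′ with closed i h c∈
  ... | s , h′ , refl with ∈-map-lookup c∈ | ∈-map-lookup z∈
  ... | y′ , y∈ , ey | u , u∈ , refl =
    u , refl , within-tuple D w′ h′ (subst (_∈ᵛ s) (f-inj ey) y∈) u∈

  module _ (B C : Structure σ) where

    ⊕-holds : ∀ i {t} → Holds (B ⊕ C) i t ⇔ UnionHolds B C i t
    ⊕-holds i {t} = mk⇔ toWitness (fromWitness {a? = unionHolds? B C i t})

    left-injective : ∀ {x y} → left B C x ≡ left B C y → x ≡ y
    left-injective = ↑ˡ-injective (size C) _ _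

    right-injective : ∀ {x y} → right B C x ≡ right B C y → x ≡ y
    right-injective = ↑ʳ-injective (size B) _ _

    left≢right : ∀ {x y} → left B C x ≢ right B C y
    left≢right {x} {y} eq with trans (sym (splitAt-↑ˡ (size B) x (size C)))
      (trans (cong (splitAt (size B)) eq) (splitAt-↑ʳ (size B) (size C) y))
    ... | ()

    within-left : ∀ r {x z} → Within (B ⊕ C) r (left B C x) z → ∃[ y ] left B C y ≡ z × Within B r x y
    within-left = within-summand (B ⊕ C) B (left B C) left-injective closed
      where
      closed : ∀ i {t x} → Holds (B ⊕ C) i t → left B C x ∈ᵛ t →
               ∃[ s ] Holds B i s × Vec.map (left B C) s ≡ t
      closed i h x∈ with to (⊕-holds i) h
      ... | inj₁ p = p
      ... | inj₂ (s , _ , refl) = ⊥-elim (left≢right (sym (proj₂ (proj₂ (∈-map-lookup x∈)))))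

    within-right : ∀ r {x z} → Within (B ⊕ C) r (right B C x) z → ∃[ y ] right B C y ≡ z × Within C r x y
    within-right = within-summand (B ⊕ C) C (right B C) right-injective closed
      where
      closed : ∀ i {t x} → Holds (B ⊕ C) i t → right B C x ∈ᵛ t →
               ∃[ s ] Holds C i s × Vec.map (right B C) s ≡ t
      closed i h x∈ with to (⊕-holds i) h
      ... | inj₁ (s , _ , refl) = ⊥-elim (left≢right (proj₂ (proj₂ (∈-map-lookup x∈))))
      ... | inj₂ p = p

  near-∷ : ∀ {n} {A : Structure σ} {v : Vec (U A) n} {r s a x} → Near A s v a →
    Near A r (a ∷ v) x → Near A (r + s) v x
  near-∷ {A = A} {r = r} (i , w) (zero , w′)  = i , within-trans A r w w′
  near-∷ {A = A} {r = r} _       (suc j , w′) = j , within-mono A (ℕ.m≤m+n r _) w′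

  -- The `r`-neighbourhood of an element within distance `s` of the old ones is contained in their
  -- `(r + s)`-neighbourhood, so the old relation covers it already.
  extend-near : ∀ {n r s A v B w} (M : Match {σ} {n} (r + s) A v B w) {a b} →
    Match.Z M a b → Near A s v a → Near B s w b → Match r A (a ∷ v) B (b ∷ w)
  extend-near {A = A} {v} {B} {w} M zab near-a near-b = record
    { Z = Z ; isPartialIso = isPartialIso
    ; points = λ { zero → zab ; (suc i) → points i }
    ; domain = domain ∘ near-∷ {A = A} {v} near-a
    ; range  = range ∘ near-∷ {A = B} {w} near-b
    }
    where open Match M

  -- A tuple meeting both r-neighbourhoods would bring a within distance 2r + 1
  -- of v, so the two partial isomorphisms can be glued.
  extend-far : ∀ {n r A v B w a C c} → Match {σ} {n} r A v B w → Match r A (a ∷ []) C (c ∷ []) →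
    ¬ Near A (suc (r + r)) v a →
    Match r A (a ∷ v) (B ⊕ C) (right B C c ∷ Vec.map (left B C) w)
  extend-far {r = r} {A} {v} {B} {w} {a} {C} {c} M M′ far = record
    { Z = Z
    ; isPartialIso = record
      { functional = functional
      ; injective  = injective
      ; preserve   = preserve
      ; reflect    = reflect
      }
    ; points = λ
      { zero    → inj₂ (within-refl A r a , c , refl , M′.points zero)
      ; (suc i) → inj₁ ((i , within-refl A r _) , _ , sym (Vec.lookup-map i (left B C) w) , M.points i) }
    ; domain = λ
      { (zero , p)  → let y , z = M′.domain (zero , p) in right B C y , inj₂ (p , y , refl , z)
      ; (suc i , p) → let y , z = M.domain (i , p) in left B C y , inj₁ ((i , p) , y , refl , z) }
    ; range = λ
      { (zero , p)  → let y , e , p′ = within-right B C r p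
                          x , z = M′.range (zero , p′)
                      in x , inj₂ (match-within (match-sym M′) r {zero} ℕ.≤-refl p′ z , y , e , z)
      ; (suc i , p) → let y , e , p′ = within-left B C r (subst (λ u → Within (B ⊕ C) r u _) (Vec.lookup-map i (left B C) w) p)
                          x , z = M.range (i , p′)
                      in x , inj₁ (match-near (match-sym M) ℕ.≤-refl (i , p′) z , y , e , z) }
    }
    where
    module M = Match M
    module M′ = Match M′

    Zˡ Zʳ Z : U A → U (B ⊕ C) → Set
    -- `M.Z` and `M′.Z` may relate elements outside the neighbourhoods. Both are cut down to them,
    -- since only there are the two domains known to be disjoint.
    Zˡ x z = Near A r v x × (∃[ y ] left B C y ≡ z × M.Z x y)
    Zʳ x z = Within A r a x × (∃[ y ] right B C y ≡ z × M′.Z x y)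
    Z x z = Zˡ x z ⊎ Zʳ x z

    apart : ∀ {x} → Near A r v x → ¬ Within A r a x
    apart (i , p) q = far (i , within-mono A (ℕ.n≤1+n _) (within-trans A r p (within-sym A r q)))

    no-edge : ∀ {x x′ i t} → Holds A i t → x ∈ᵛ t → x′ ∈ᵛ t → Near A r v x → ¬ Within A r a x′
    no-edge h x∈ x′∈ (i , p) q =
      far (i , subst (λ s → Within A s (lookup v i) a) (ℕ.+-suc r r)
        (within-trans A r (within-tuple A p h x∈ x′∈) (within-sym A r q)))

    functional : ∀ {x z z′} → Z x z → Z x z′ → z ≡ z′
    functional (inj₁ (_ , _ , refl , p)) (inj₁ (_ , _ , refl , q)) = cong (left B C) (M.functional p q)
    functional (inj₁ (p , _))            (inj₂ (q , _))            = ⊥-elim (apart p q)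
    functional (inj₂ (q , _))            (inj₁ (p , _))            = ⊥-elim (apart p q)
    functional (inj₂ (_ , _ , refl , p)) (inj₂ (_ , _ , refl , q)) = cong (right B C) (M′.functional p q)

    leftZ : ∀ {x y} → Z x (left B C y) → M.Z x y
    leftZ (inj₁ (_ , _ , e , p)) = subst (M.Z _) (left-injective B C e) p
    leftZ (inj₂ (_ , _ , e , _)) = ⊥-elim (left≢right B C (sym e))

    rightZ : ∀ {x y} → Z x (right B C y) → M′.Z x y
    rightZ (inj₁ (_ , _ , e , _)) = ⊥-elim (left≢right B C e)
    rightZ (inj₂ (_ , _ , e , p)) = subst (M′.Z _) (right-injective B C e) p

    injective : ∀ {x x′ z} → Z x z → Z x′ z → x ≡ x′
    injective (inj₁ (_ , _ , refl , p)) q = M.injective p (leftZ q)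
    injective (inj₂ (_ , _ , refl , p)) q = M′.injective p (rightZ q)

    preserve : ∀ i {s t} → (∀ k → Z (lookup s k) (lookup t k)) → Holds A i s → Holds (B ⊕ C) i t
    -- Arities are positive, so the tuple has a first entry. By `no-edge` all other entries lie on
    -- the same side as this one.
    preserve i {s} {t} z h with side (z first)
      where
      first : Fin (arity σ i)
      first = fromℕ< (arity≥1 σ i)

      side : Z (lookup s first) (lookup t first) →
        (∀ k → Zˡ (lookup s k) (lookup t k)) ⊎ (∀ k → Zʳ (lookup s k) (lookup t k))
      side (inj₁ (near , _)) = inj₁ λ k → fromInj₁
        (λ { (p , _) → ⊥-elim (no-edge h (∈ᵛ-lookup first s) (∈ᵛ-lookup k s) near p) }) (z k)
      side (inj₂ (p , _)) = inj₂ λ k → fromInj₂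
        (λ { (near , _) → ⊥-elim (no-edge h (∈ᵛ-lookup k s) (∈ᵛ-lookup first s) near p) }) (z k)
    ... | inj₁ zˡ = from (⊕-holds B C i) (inj₁ (u ,
          M.preserve i (tabulate-related M.Z s λ k → proj₁ (proj₂ (zˡ k)) , proj₂ (proj₂ (proj₂ (zˡ k)))) h ,
          lookup-ext λ k → trans (Vec.lookup-map k _ u)
            (trans (cong (left B C) (Vec.lookup∘tabulate _ k)) (proj₁ (proj₂ (proj₂ (zˡ k)))))))
      where u = tabulate (λ k → proj₁ (proj₂ (zˡ k)))
    ... | inj₂ zʳ = from (⊕-holds B C i) (inj₂ (u ,
          M′.preserve i (tabulate-related M′.Z s λ k → proj₁ (proj₂ (zʳ k)) , proj₂ (proj₂ (proj₂ (zʳ k)))) h ,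
          lookup-ext λ k → trans (Vec.lookup-map k _ u)
            (trans (cong (right B C) (Vec.lookup∘tabulate _ k)) (proj₁ (proj₂ (proj₂ (zʳ k)))))))
      where u = tabulate (λ k → proj₁ (proj₂ (zʳ k)))

    reflect : ∀ i {s t} → (∀ k → Z (lookup s k) (lookup t k)) → Holds (B ⊕ C) i t → Holds A i s
    reflect i {s} z h with to (⊕-holds B C i) h
    ... | inj₁ (u , h′ , refl) = M.reflect i {s} (λ k → leftZ (subst (Z (lookup s k)) (Vec.lookup-map k _ u) (z k))) h′
    ... | inj₂ (u , h′ , refl) = M′.reflect i {s} (λ k → rightZ (subst (Z (lookup s k)) (Vec.lookup-map k _ u) (z k))) h′

  -- Counting elements of one r-type

  match-head : ∀ {n r A v B w a b} → Match {σ} {suc n} r A (a ∷ v) B (b ∷ w) → Match r A (a ∷ []) B (b ∷ [])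
  match-head M = record
    { Z = Z ; isPartialIso = isPartialIso
    ; points = λ { zero → points zero }
    ; domain = λ { (zero , p) → domain (zero , p) }
    ; range  = λ { (zero , p) → range (zero , p) }
    }
    where open Match M

  infix 4 _~[_]_ _~?[_]_

  _~[_]_ : PointedStructure σ → ℕ → PointedStructure σ → Set
  𝔸 ~[ r ] 𝔹 = 𝒩 (structure 𝔸) r (point 𝔸) ≅• 𝒩 (structure 𝔹) r (point 𝔹)

  _~?[_]_ : ∀ 𝔸 r 𝔹 → Dec (𝔸 ~[ r ] 𝔹)
  𝔸 ~?[ r ] 𝔹 = 𝒩 (structure 𝔸) r (point 𝔸) ≅•? 𝒩 (structure 𝔹) r (point 𝔹)

  ~⇒match : ∀ {r A a B b} → (A at a) ~[ r ] (B at b) → Match r A (a ∷ []) B (b ∷ [])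
  ~⇒match {r} {A} {a} {B} {b} = charts⇒match (𝒩-chart r A a) (𝒩-chart r B b)

  match⇒~ : ∀ {r A a B b} → Match r A (a ∷ []) B (b ∷ []) → (A at a) ~[ r ] (B at b)
  match⇒~ {r} {A} {a} {B} {b} = match⇒charts (𝒩-chart r A a) (𝒩-chart r B b)

  count : (A : Structure σ) → ℕ → PointedStructure σ → ℕ
  count A r 𝔹 = length (filter (λ a → (A at a) ~?[ r ] 𝔹) (allFin (size A)))

  -- Beyond distance `suc (r + r)` an element can be matched by a separate component, by
  -- `extend-far`. The copies up to that distance are therefore counted apart.
  NearCopy : ∀ {n} (A : Structure σ) → Vec (U A) n → ℕ → PointedStructure σ → U A → Set
  NearCopy A v r 𝔹 a = Near A (suc (r + r)) v a × (A at a) ~[ r ] 𝔹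

  nearCopy? : ∀ {n} A (v : Vec (U A) n) r 𝔹 → Decidable (NearCopy A v r 𝔹)
  nearCopy? A v r 𝔹 a = near? A (suc (r + r)) v a ×-dec (A at a) ~?[ r ] 𝔹

  nearCount : ∀ {n} (A : Structure σ) → Vec (U A) n → ℕ → PointedStructure σ → ℕ
  nearCount A v r 𝔹 = length (filter (nearCopy? A v r 𝔹) (allFin (size A)))

  occurrences : List (PointedStructure σ) → ℕ → PointedStructure σ → ℕ
  occurrences H r 𝔹 = length (filter (λ ℂ → ℂ ~?[ r ] 𝔹) H)

  nearCount-cong : ∀ {n B} {w : Vec (U B) n} {r 𝔹 ℂ} → 𝔹 ~[ r ] ℂ → nearCount B w r 𝔹 ≡ nearCount B w r ℂ
  nearCount-cong {B = B} {w} {r} {𝔹} {ℂ} e = cong length (List.filter-≐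
    (nearCopy? B w r 𝔹) (nearCopy? B w r ℂ)
    ((λ (n , c) → n , ≅•-trans c e) , (λ (n , c) → n , ≅•-trans c (≅•-sym e))) (allFin (size B)))

  occurrences-cong : ∀ {H r 𝔹 ℂ} → 𝔹 ~[ r ] ℂ → occurrences H r 𝔹 ≡ occurrences H r ℂ
  occurrences-cong {H} {r} {𝔹} {ℂ} e = cong length (List.filter-≐
    (λ 𝔻 → 𝔻 ~?[ r ] 𝔹) (λ 𝔻 → 𝔻 ~?[ r ] ℂ)
    ((λ c → ≅•-trans c e) , (λ c → ≅•-trans c (≅•-sym e))) H)

  -- The near elements lie in a union of `n` balls of radius `suc (r + r)`, whose sizes are bounded
  -- in terms of the degree alone, however large `A` is.
  nearCount-bound : ∀ {n d A} (v : Vec (U A) n) r 𝔹 → 𝒞 σ d A →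
    nearCount A v r 𝔹 ≤ n * ballBound σ d (suc (r + r))
  nearCount-bound {n} {d} {A} v r 𝔹 deg = ℕ.≤-trans
    (length-≤ _≡_ (filter⁺ (nearCopy? A v r 𝔹) (allFin⁺ (size A))) (λ { refl refl → refl })
      λ {x} x∈ → x , reached (proj₁ (proj₂ (∈-filter⁻ (nearCopy? A v r 𝔹) {xs = allFin (size A)} x∈))) , refl)
    (subst (λ m → length (List.concatMap (reach A s) (Vec.toList v)) ≤ m * ballBound σ d s)
      (Vec.length-toList v)
      (length-concatMap-uniform (reach A s) _ (length-reach A deg s) (Vec.toList v)))
    where
    s = suc (r + r)
    reached : ∀ {x} → Near A s v x → x ∈ List.concatMap (reach A s) (Vec.toList v)
    reached (i , p) = ∈-concatMap⁺ (reach A s) (lose (∈-toList⁺ (∈ᵛ-lookup i v)) (within⇒∈reach A s p))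

  -- The radius leaves room for the `r`-neighbourhoods of all near elements, so partners have the
  -- same `r`-type. With `match-sym` the two counts are equal.
  nearCount-match : ∀ {n r A v B w} → Match {σ} {n} (r + suc (r + r)) A v B w →
    ∀ 𝔹 → nearCount A v r 𝔹 ≤ nearCount B w r 𝔹
  nearCount-match {r = r} {A} {v} {B} {w} M 𝔹 = count-≤ (nearCopy? A v r 𝔹) (nearCopy? B w r 𝔹) Z injective
    λ {x} (near , c) →
      let near′ = near-mono {A = A} {v} (ℕ.m≤n+m _ r) near
          y , z = domain near′
          near-y = match-near M (ℕ.m≤n+m _ r) near z
      in y , (near-y , ≅•-trans (≅•-sym (match⇒~ (match-head (extend-near {r = r} M z near near-y)))) c) , z
    where open Match M

  -- Back and forth over one quantifier

  -- All radii up to `R` are compared, since each quantifier consults the counts at the radius of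
  -- its own body.
  record Agree (A : Structure σ) (H : List (PointedStructure σ)) (R t : ℕ) : Set where
    constructor mkAgree
    field agreement : ∀ r 𝔹 → r ≤ R → count A r 𝔹 ≃[ t ] occurrences H r 𝔹

  open Agree

  -- The near copies are counted in `B`, the structure at hand during evaluation. By
  -- `nearCount-match` the count in the represented structure is the same.
  record Fresh (H : List (PointedStructure σ)) {n} (B : Structure σ) (w : Vec (U B) n)
    (r : ℕ) (𝔹 : PointedStructure σ) : Set where
    constructor mkFresh
    field surplus : suc (nearCount B w r 𝔹) ≤ occurrences H r 𝔹

  open Fresh

  fresh? : ∀ H {n} B (w : Vec (U B) n) r → Decidable (Fresh H B w r)
  fresh? H B w r 𝔹 = map′ mkFresh surplus (suc (nearCount B w r 𝔹) ℕ.≤? occurrences H r 𝔹)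

  extension : ∀ {n} (B : Structure σ) → Vec (U B) n → (𝔹 : PointedStructure σ) → Vec (U (B ⊕ structure 𝔹)) (suc n)
  extension B w (C at c) = right B C c ∷ Vec.map (left B C) w

  module _ {d R t A H} (deg : 𝒞 σ d A) (agree : Agree A H R t)
    {n r} (r≤R : r ≤ R) (bound : suc (n * ballBound σ d (suc (r + r))) ≤ t)
    {v : Vec (U A) n} {B w} (M : Match (r + suc (r + r)) A v B w) where
    open Match M

    private
      M↓ : Match r A v B w
      M↓ = match-mono (ℕ.m≤m+n r _) M

    -- `a` is itself a copy that is not near, so its type has more copies in `A` than near `v`. By
    -- the degree bound this surplus shows up no later than at `t`, so it is visible in `H`, and any
    -- entry of `H` of the same type can replace the neighbourhood of `a`.
    forth-far : ∀ {a} → ¬ Near A (suc (r + r)) v a →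
      ∃[ 𝔹 ] 𝔹 ∈ H × Fresh H B w r 𝔹 × Match r A (a ∷ v) (B ⊕ structure 𝔹) (extension B w 𝔹)
    forth-far {a} far = 𝔹 , 𝔹∈H , fresh , extend-far M↓ (~⇒match (≅•-sym 𝔹~𝔸)) far
      where
      𝔸 = A at a
      same? : Decidable (λ b → (A at b) ~[ r ] 𝔸)
      same? b = (A at b) ~?[ r ] 𝔸

      nearCopy : ∀ {x} → x ∈ filter (nearCopy? A v r 𝔸) (allFin (size A)) → NearCopy A v r 𝔸 x
      nearCopy x∈ = proj₂ (∈-filter⁻ (nearCopy? A v r 𝔸) {xs = allFin (size A)} x∈)

      more : suc (nearCount A v r 𝔸) ≤ count A r 𝔸
      -- `a` is put in front of the list of near copies, which stays free of repetitions because `a`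
      -- is far.
      more = length-≤ _≡_
        (All.tabulate (λ { x∈ refl → far (proj₁ (nearCopy x∈)) })
          ∷ filter⁺ (nearCopy? A v r 𝔸) (allFin⁺ (size A)))
        (λ { refl refl → refl })
        λ { (Any.here refl) → a , ∈-filter⁺ same? (∈-allFin a) ≅•-refl , refl
          ; {x} (Any.there x∈) → x , ∈-filter⁺ same? (∈-allFin x) (proj₂ (nearCopy x∈)) , refl }

      more-in-H : suc (nearCount A v r 𝔸) ≤ occurrences H r 𝔸
      more-in-H = ≃-transfer (agreement agree r 𝔸 r≤R) (ℕ.≤-trans (s≤s (nearCount-bound {d = d} v r 𝔸 deg)) bound) more

      witness : ∃[ 𝔹 ] 𝔹 ∈ filter (λ 𝔹 → 𝔹 ~?[ r ] 𝔸) H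
      witness = nonempty more-in-H

      𝔹 : PointedStructure σ
      𝔹 = proj₁ witness

      𝔹∈H : 𝔹 ∈ H
      𝔹∈H = proj₁ (∈-filter⁻ (λ 𝔹 → 𝔹 ~?[ r ] 𝔸) {xs = H} (proj₂ witness))

      𝔹~𝔸 : 𝔹 ~[ r ] 𝔸
      𝔹~𝔸 = proj₂ (∈-filter⁻ (λ 𝔹 → 𝔹 ~?[ r ] 𝔸) {xs = H} (proj₂ witness))

      fresh : Fresh H B w r 𝔹
      fresh = mkFresh (begin
        suc (nearCount B w r 𝔹)  ≡⟨ cong suc (nearCount-cong {B = B} {w} 𝔹~𝔸) ⟩
        suc (nearCount B w r 𝔸)  ≤⟨ s≤s (nearCount-match (match-sym M) 𝔸) ⟩
        suc (nearCount A v r 𝔸)  ≤⟨ more-in-H ⟩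
        occurrences H r 𝔸        ≡⟨ occurrences-cong {H} 𝔹~𝔸 ⟨
        occurrences H r 𝔹        ∎)
        where open ℕ.≤-Reasoning

    -- The surplus recorded in `H` is transferred back to `A`. If the finite search found no far
    -- copy, all copies in `A` would be near and could not outnumber the near ones.
    back-far : ∀ {𝔹} → Fresh H B w r 𝔹 →
      ∃[ a ] Match r A (a ∷ v) (B ⊕ structure 𝔹) (extension B w 𝔹)
    back-far {𝔹} fresh with any? (λ a → ¬? (near? A (suc (r + r)) v a) ×-dec (A at a) ~?[ r ] 𝔹)
    ... | yes (a , far , a~𝔹) = a , extend-far M↓ (~⇒match a~𝔹) far
    ... | no ¬far = ⊥-elim (ℕ.<-irrefl refl (ℕ.≤-trans more all-near))
      where
      more : suc (nearCount A v r 𝔹) ≤ count A r 𝔹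
      more = ≃-transfer (≃-sym (agreement agree r 𝔹 r≤R)) (ℕ.≤-trans (s≤s (nearCount-bound {d = d} v r 𝔹 deg)) bound)
        (ℕ.≤-trans (s≤s (nearCount-match M 𝔹)) (surplus fresh))

      all-near : count A r 𝔹 ≤ nearCount A v r 𝔹
      all-near = count-≤ (λ a → (A at a) ~?[ r ] 𝔹) (nearCopy? A v r 𝔹) _≡_ (λ { refl refl → refl })
        λ {x} c → x , (decidable-stable (near? A (suc (r + r)) v x) (λ far → ¬far (x , far , c)) , c) , refl

    forth : ∀ a →
      (∃[ b ] Near B (suc (r + r)) w b × Match r A (a ∷ v) B (b ∷ w)) ⊎
      (∃[ 𝔹 ] 𝔹 ∈ H × Fresh H B w r 𝔹 × Match r A (a ∷ v) (B ⊕ structure 𝔹) (extension B w 𝔹))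
    forth a with near? A (suc (r + r)) v a
    ... | no far = inj₂ (forth-far far)
    ... | yes near =
      let b , zab = domain (near-mono {A = A} {v} (ℕ.m≤n+m _ r) near)
          near-b  = match-near M (ℕ.m≤n+m _ r) near zab
      in inj₁ (b , near-b , extend-near M zab near near-b)

    back-near : ∀ {b} → Near B (suc (r + r)) w b → ∃[ a ] Match r A (a ∷ v) B (b ∷ w)
    back-near near =
      let a , zab = range (near-mono {A = B} {w} (ℕ.m≤n+m _ r) near)
      in a , extend-near M zab (match-near (match-sym M) (ℕ.m≤n+m _ r) near zab) near

  -- Virtual evaluation

  -- A quantifier turns radius `r` into `3r + 1`: a near choice may be at distance `2r + 1` from the
  -- old elements, and its `r`-neighbourhood must still be matched.
  radius : ∀ {n} → Formula σ n → ℕ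
  radius (equal _ _) = 0
  radius (atom _ _)  = 0
  radius (neg φ)     = radius φ
  radius (conj φ ψ)  = radius φ ⊔ radius ψ
  radius (disj φ ψ)  = radius φ ⊔ radius ψ
  radius (exist φ)   = radius φ + suc (radius φ + radius φ)
  radius (univ φ)    = radius φ + suc (radius φ + radius φ)

  -- At a quantifier, one more than the bound of `nearCount-bound` for the `n` elements in scope, so
  -- that truncation never hides a surplus over the near copies.
  threshold : ∀ {n} → ℕ → Formula σ n → ℕ
  threshold d (equal _ _)   = 0
  threshold d (atom _ _)    = 0
  threshold d (neg φ)       = threshold d φ
  threshold d (conj φ ψ)    = threshold d φ ⊔ threshold d ψ
  threshold d (disj φ ψ)    = threshold d φ ⊔ threshold d ψ
  threshold {n} d (exist φ) = threshold d φ ⊔ suc (n * ballBound σ d (suc (radius φ + radius φ)))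
  threshold {n} d (univ φ)  = threshold d φ ⊔ suc (n * ballBound σ d (suc (radius φ + radius φ)))

  -- H stands for the unknown structure as a multiset of balls, and B for the
  -- part of it around the elements w already chosen. A quantifier ranges over
  -- the elements of B near w and over the balls in H that occur more often than
  -- they do near w, hence also far from w.
  module _ (H : List (PointedStructure σ)) where

    Eval : ∀ {n} (B : Structure σ) → Vec (U B) n → Formula σ n → Set
    Eval B w (equal x y) = lookup w x ≡ lookup w y
    Eval B w (atom i x)  = Holds B i (Vec.map (lookup w) x)
    Eval B w (neg φ)     = ¬ Eval B w φ
    Eval B w (conj φ ψ)  = Eval B w φ × Eval B w ψ
    Eval B w (disj φ ψ)  = Eval B w φ ⊎ Eval B w ψ
    Eval B w (exist φ)   =
      (∃[ b ] Near B (suc (radius φ + radius φ)) w b × Eval B (b ∷ w) φ) ⊎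
      Any (λ 𝔹 → Fresh H B w (radius φ) 𝔹 × Eval (B ⊕ structure 𝔹) (extension B w 𝔹) φ) H
    Eval B w (univ φ)    =
      (∀ b → Near B (suc (radius φ + radius φ)) w b → Eval B (b ∷ w) φ) ×
      All (λ 𝔹 → Fresh H B w (radius φ) 𝔹 → Eval (B ⊕ structure 𝔹) (extension B w 𝔹) φ) H

    -- Both ranges of a quantifier are finite. Decidability is what allows the truncated histograms
    -- that satisfy a sentence to be selected by filtering.
    eval? : ∀ {n} B (w : Vec (U B) n) φ → Dec (Eval B w φ)
    eval? B w (equal x y) = lookup w x ≟ lookup w y
    eval? B w (atom i x)  = T? _
    eval? B w (neg φ)     = ¬? (eval? B w φ)
    eval? B w (conj φ ψ)  = eval? B w φ ×-dec eval? B w ψ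
    eval? B w (disj φ ψ)  = eval? B w φ ⊎-dec eval? B w ψ
    eval? B w (exist φ)   =
      any? (λ b → near? B _ w b ×-dec eval? B (b ∷ w) φ) ⊎-dec
      Any.any? (λ 𝔹 → fresh? H B w _ 𝔹 ×-dec eval? (B ⊕ structure 𝔹) (extension B w 𝔹) φ) H
    eval? B w (univ φ)    =
      all? (λ b → near? B _ w b →-dec eval? B (b ∷ w) φ) ×-dec
      All.all? (λ 𝔹 → fresh? H B w _ 𝔹 →-dec eval? (B ⊕ structure 𝔹) (extension B w 𝔹) φ) H

  lookup-preserved : ∀ {n r A v B w} (M : Match {σ} {n} r A v B w) {k} (x : Vec (Fin n) k) →
    ∀ j → Match.Z M (lookup (Vec.map (lookup v) x) j) (lookup (Vec.map (lookup w) x) j)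
  lookup-preserved M (x ∷ xs) zero    = Match.points M x
  lookup-preserved M (x ∷ xs) (suc j) = lookup-preserved M xs j

  module _ {d R t A H} (deg : 𝒞 σ d A) (agree : Agree A H R t) where

    -- An Ehrenfeucht-Fraïssé argument by induction on the formula: the match settles the atoms, and
    -- `forth`, `back-near` and `back-far` answer a quantifier with a match of the radius of its
    -- body. `B` has to vary, since far choices enlarge it.
    satisfies⇔eval : ∀ {n} (φ : Formula σ n) {v B w} → radius φ ≤ R → threshold d φ ≤ t →
      Match (radius φ) A v B w → Satisfies A v φ ⇔ Eval H B w φ
    satisfies⇔eval (equal x y) _ _ M = mk⇔
      (λ e → functional (points x) (subst (λ a → Z a _) (sym e) (points y)))
      (λ e → injective (points x) (subst (Z _) (sym e) (points y)))
      where open Match M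
    satisfies⇔eval (atom i x) _ _ M = mk⇔ (preserve i (lookup-preserved M x)) (reflect i (lookup-preserved M x))
      where open Match M
    satisfies⇔eval (neg φ) r≤R t≤ M = let ih = satisfies⇔eval φ r≤R t≤ M in mk⇔ (_∘ from ih) (_∘ to ih)
    satisfies⇔eval (conj φ ψ) r≤R t≤ M =
      satisfies⇔eval φ (ℕ.m⊔n≤o⇒m≤o _ _ r≤R) (ℕ.m⊔n≤o⇒m≤o _ _ t≤) (match-mono (ℕ.m≤m⊔n _ _) M) ×-⇔
      satisfies⇔eval ψ (ℕ.m⊔n≤o⇒n≤o _ _ r≤R) (ℕ.m⊔n≤o⇒n≤o _ _ t≤) (match-mono (ℕ.m≤n⊔m _ _) M)
    satisfies⇔eval (disj φ ψ) r≤R t≤ M =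
      satisfies⇔eval φ (ℕ.m⊔n≤o⇒m≤o _ _ r≤R) (ℕ.m⊔n≤o⇒m≤o _ _ t≤) (match-mono (ℕ.m≤m⊔n _ _) M) ⊎-⇔
      satisfies⇔eval ψ (ℕ.m⊔n≤o⇒n≤o _ _ r≤R) (ℕ.m⊔n≤o⇒n≤o _ _ t≤) (match-mono (ℕ.m≤n⊔m _ _) M)
    satisfies⇔eval (exist φ) {v} {B} {w} r≤R t≤ M = mk⇔ forward backward
      where
      φ≤R = ℕ.m+n≤o⇒m≤o (radius φ) r≤R
      bound = ℕ.m⊔n≤o⇒n≤o (threshold d φ) _ t≤
      ih : ∀ {v B w} → Match (radius φ) A v B w → Satisfies A v φ ⇔ Eval H B w φ
      ih = satisfies⇔eval φ φ≤R (ℕ.m⊔n≤o⇒m≤o _ _ t≤)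

      forward : Satisfies A v (exist φ) → Eval H B w (exist φ)
      forward (a , s) with forth {d = d} deg agree φ≤R bound M a
      ... | inj₁ (b , near , M′)        = inj₁ (b , near , to (ih M′) s)
      ... | inj₂ (𝔹 , 𝔹∈ , fresh , M′) = inj₂ (lose 𝔹∈ (fresh , to (ih M′) s))

      backward : Eval H B w (exist φ) → Satisfies A v (exist φ)
      backward (inj₁ (b , near , e)) =
        let a , M′ = back-near {d = d} deg agree φ≤R bound M near in a , from (ih M′) e
      backward (inj₂ p) =
        let _ , _ , fresh , e = find p
            a , M′ = back-far {d = d} deg agree φ≤R bound M fresh
        in a , from (ih M′) e
    satisfies⇔eval (univ φ) {v} {B} {w} r≤R t≤ M = mk⇔ forward backward
      where
      φ≤R = ℕ.m+n≤o⇒m≤o (radius φ) r≤R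
      bound = ℕ.m⊔n≤o⇒n≤o (threshold d φ) _ t≤
      ih : ∀ {v B w} → Match (radius φ) A v B w → Satisfies A v φ ⇔ Eval H B w φ
      ih = satisfies⇔eval φ φ≤R (ℕ.m⊔n≤o⇒m≤o _ _ t≤)

      forward : Satisfies A v (univ φ) → Eval H B w (univ φ)
      forward s =
        (λ b near → let a , M′ = back-near {d = d} deg agree φ≤R bound M near in to (ih M′) (s a)) ,
        All.tabulate λ _ fresh → let a , M′ = back-far {d = d} deg agree φ≤R bound M fresh in to (ih M′) (s a)

      backward : Eval H B w (univ φ) → Satisfies A v (univ φ)
      backward (es , fs) a with forth {d = d} deg agree φ≤R bound M a
      ... | inj₁ (b , near , M′)        = from (ih M′) (es b near)
      ... | inj₂ (𝔹 , 𝔹∈ , fresh , M′) = from (ih M′) (All.lookup fs 𝔹∈ fresh)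

  -- The start of the game: no element is chosen, so no neighbourhood has to be covered. As arities
  -- are positive, there are no tuples over an empty universe and the conditions on relations are
  -- vacuous.
  match-empty : ∀ {r} {A : Structure σ} → Match r A [] empty []
  match-empty = record
    { Z            = λ _ ()
    ; isPartialIso = record
      { functional = λ { {y = ()} }
      ; injective  = λ { {y = ()} }
      ; preserve   = λ i {s} {t} → ⊥-elim (no-tuple t)
      ; reflect    = λ i {s} {t} → ⊥-elim (no-tuple t)
      }
    ; points = λ ()
    ; domain = λ { (() , _) }
    ; range  = λ { (() , _) }
    }
    where
    no-tuple : ∀ {i} → Vec (Fin 0) (arity σ i) → ⊥
    no-tuple {i} t with lookup t (fromℕ< (arity≥1 σ i))
    ... | ()

  sentence⇔eval : ∀ {d A H} (φ : Sentence σ) → 𝒞 σ d A → Agree A H (radius φ) (threshold d φ) →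
    A ⊨ φ ⇔ Eval H empty [] φ
  sentence⇔eval φ deg agree = satisfies⇔eval deg agree φ ℕ.≤-refl ℕ.≤-refl match-empty

-- Neighbourhood histograms

module _ {σ : Signature} where

  module _ {r A a 𝔸} (C : Chart {σ} r A a 𝔸) where
    open Chart C

    -- Distances might grow in passing to an induced substructure. Up to `r` they do not: the
    -- embedding is a match, and `match-within` pulls walks from `a` back along it.
    chart-isBall : IsBall r 𝔸
    chart-isBall x = match-within chart-match r {zero} ℕ.≤-refl (within x) refl
      where
      strong-tuple : ∀ i {s t} → (∀ k → embed (lookup t k) ≡ lookup s k) → rel A i s ≡ rel (structure 𝔸) i t
      strong-tuple i {s} {t} z = trans (cong (rel A i) (sym (lookup-ext λ k → trans (Vec.lookup-map k embed t) (z k))))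
        (sym (strong i t))

      chart-match : Match r A (a ∷ []) (structure 𝔸) (point 𝔸 ∷ [])
      chart-match = record
        { Z            = λ x u → embed u ≡ x
        ; isPartialIso = record
          { functional = λ e e′ → injective (trans e (sym e′))
          ; injective  = λ e e′ → trans (sym e) e′
          ; preserve   = λ i z → subst T (strong-tuple i z)
          ; reflect    = λ i z → subst T (sym (strong-tuple i z))
          }
        ; points = λ { zero → pointed }
        ; domain = λ { (zero , w) → covers w }
        ; range  = λ {u} _ → embed u , refl
        }

    -- `embed` sends the tuples through an element injectively to tuples of `A` through its image,
    -- so no degree grows.
    chart-degree : ∀ {d} → 𝒞 σ d A → 𝒞 σ d (structure 𝔸)
    chart-degree deg = max≤v⁺ z≤n (map⁺ (All.universal (λ x → ℕ.≤-trans
      (sum-mono (λ i → length-incident i x) (allFin (symbols σ)))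
      (ℕ.≤-trans (elementDegree≤degree A (embed x)) deg)) (allFin (size (structure 𝔸)))))
      where
      map-injective : ∀ {k} {s t : Vec _ k} → Vec.map embed s ≡ Vec.map embed t → s ≡ t
      map-injective {s = []}    {[]}    _ = refl
      map-injective {s = x ∷ s} {y ∷ t} e =
        cong₂ _∷_ (injective (Vec.∷-injectiveˡ e)) (map-injective (Vec.∷-injectiveʳ e))

      length-incident : ∀ i x → length (incidentTuples (structure 𝔸) x i) ≤ length (incidentTuples A (embed x) i)
      length-incident i x = length-≤ (λ s t → Vec.map embed s ≡ t)
        (filter⁺ (incident? (structure 𝔸) x i) (allTuples-unique _ _))
        (λ e e′ → map-injective (trans e (sym e′)))
        λ {s} s∈ → let _ , h , x∈ = ∈-filter⁻ (incident? (structure 𝔸) x i) {xs = allTuples _ _} s∈ in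
          Vec.map embed s ,
          ∈-filter⁺ (incident? A (embed x) i) (allTuples-complete _) (subst T (strong i s) h , ∈-map⁺ᵛ embed x∈) , refl

  module _ {d r : ℕ} (E : TypeEnumeration σ d r) where

    hasType⇒match : ∀ {A i a} → HasType E A i a → Match r A (a ∷ []) (structure (τ E i)) (point (τ E i) ∷ [])
    hasType⇒match {A} {i} {a} = charts⇒match (𝒩-chart r A a) (ball-chart (isBall E i))

    match⇒hasType : ∀ {A i a} → Match r A (a ∷ []) (structure (τ E i)) (point (τ E i) ∷ []) → HasType E A i a
    match⇒hasType {A} {i} {a} = match⇒charts (𝒩-chart r A a) (ball-chart (isBall E i))

    typeOf : ∀ {A} → 𝒞 σ d A → ∀ a → ∃[ i ] HasType E A i a
    typeOf {A} deg a = complete E (𝒩 A r a) (chart-isBall (𝒩-chart r A a)) (chart-degree (𝒩-chart r A a) deg)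

    multiset : (Fin (number E) → ℕ) → List (PointedStructure σ)
    multiset g = concatMap (λ i → replicate (g i) (τ E i)) (allFin (number E))

    module _ (A : Structure σ) where

      ofType : Fin (number E) → List (U A)
      ofType i = filter (hasType? E A i) (allFin (size A))

      ofType⁻ : ∀ {i a} → a ∈ ofType i → HasType E A i a
      ofType⁻ {i} a∈ = proj₂ (∈-filter⁻ (hasType? E A i) {xs = allFin (size A)} a∈)

      -- If `A` has degree at most `d`, each element has exactly one type and this is a
      -- rearrangement of the universe. It splits every count into one contribution per type.
      byType : List (U A)
      byType = concatMap ofType (allFin (number E))

      byType-unique : Unique byType
      byType-unique = concat⁺
        (map⁺ (All.universal (λ i → filter⁺ (hasType? E A i) (allFin⁺ (size A))) _))
        (AllPairs.map⁺ {f = ofType} (AllPairs.map disjoint (allFin⁺ (number E))))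
        where
        disjoint : ∀ {i j} → i ≢ j → Disjoint (ofType i) (ofType j)
        disjoint i≢j (a∈i , a∈j) = i≢j (distinct E (≅•-trans (≅•-sym (ofType⁻ a∈i)) (ofType⁻ a∈j)))

      module _ (deg : 𝒞 σ d A) where

        ∈-byType : ∀ a → a ∈ byType
        ∈-byType a = let i , h = typeOf deg a in
          ∈-concatMap⁺ ofType (lose (∈-allFin i) (∈-filter⁺ (hasType? E A i) (∈-allFin a) h))

        count-byType : ∀ {P : U A → Set} (P? : Decidable P) →
          length (filter P? (allFin (size A))) ≡ length (filter P? byType)
        count-byType P? = ℕ.≤-antisym
          (length-≤ _≡_ (filter⁺ P? (allFin⁺ (size A))) (λ { refl refl → refl })
            λ {x} x∈ → x , ∈-filter⁺ P? (∈-byType x) (proj₂ (∈-filter⁻ P? {xs = allFin (size A)} x∈)) , refl)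
          (length-≤ _≡_ (filter⁺ P? byType-unique) (λ { refl refl → refl })
            λ {x} x∈ → x , ∈-filter⁺ P? (∈-allFin x) (proj₂ (∈-filter⁻ P? {xs = byType} x∈)) , refl)

        -- An `r`-type determines the `s`-type for every `s` up to `r`. A given `s`-type is thus
        -- shared by a whole block of elements of one `r`-type or by none of it, and in the first
        -- case the block sizes agree up to `t` by assumption.
        agree-multiset : ∀ {t} (g : Fin (number E) → ℕ) → (∀ i → histogram E A i ≃[ t ] g i) →
          Agree A (multiset g) r t
        agree-multiset {t} g hist = mkAgree λ s 𝔹 s≤r →
          let P? = λ a → (A at a) ~?[ s ] 𝔹
              Q? = λ ℂ → ℂ ~?[ s ] 𝔹
              τ~ : ∀ {i a} → a ∈ ofType i → (A at a) ~[ s ] τ E i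
              τ~ a∈ = match⇒~ (match-mono s≤r (hasType⇒match (ofType⁻ a∈)))
              pointwise : ∀ i → length (filter P? (ofType i)) ≃[ t ] length (filter Q? (replicate (g i) (τ E i)))
              pointwise i = case τ E i ~?[ s ] 𝔹 of λ
                { (yes e) → subst₂ _≃[ t ]_
                    (cong length (sym (List.filter-all P? {xs = ofType i} (All.tabulate λ a∈ → ≅•-trans (τ~ a∈) e))))
                    (sym (trans (cong length (List.filter-all Q? (replicate⁺ (g i) e))) (List.length-replicate (g i))))
                    (hist i)
                ; (no ¬e) → inj₁ (trans
                    (cong length (List.filter-none P? {xs = ofType i}
                      (All.tabulate λ a∈ c → ¬e (≅•-trans (≅•-sym (τ~ a∈)) c))))
                    (sym (cong length (List.filter-none Q? (replicate⁺ (g i) ¬e)))))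
                }
          in subst (_≃[ t ] _) (sym (count-byType P?))
               (≃-concatMap P? Q? ofType (λ i → replicate (g i) (τ E i)) pointwise (allFin (number E)))

-- From sentences to unions of profiles

-- An entry below `t` prescribes the count exactly, while the entry `t` stands for all counts from
-- `t` on.
capped : ℕ → ℕ → Interval
capped t k with k ℕ.<? t
... | yes _ = [ k , k ]⟨ ℕ.≤-refl ⟩
... | no  _ = [ k ,∞⟩

∈-capped⇒≃ : ∀ {t k m} → m ∈ᴵ capped t k → m ≃[ t ] k
∈-capped⇒≃ {t} {k} m∈ with k ℕ.<? t
∈-capped⇒≃ (k≤m , m≤k) | yes _  = inj₁ (ℕ.≤-antisym m≤k k≤m)
∈-capped⇒≃ k≤m         | no k≮t = inj₂ (ℕ.≤-trans (ℕ.≮⇒≥ k≮t) k≤m , ℕ.≮⇒≥ k≮t)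

∈-capped-⊓ : ∀ t m → m ∈ᴵ capped t (m ⊓ t)
∈-capped-⊓ t m with m ⊓ t ℕ.<? t
... | no _  = ℕ.m⊓n≤m m t
-- A minimum strictly below `t` can only be `m` itself.
... | yes p with ℕ.≤-total m t
...   | inj₁ m≤t = ℕ.m⊓n≤m m t , ℕ.≤-reflexive (sym (ℕ.m≤n⇒m⊓n≡m m≤t))
...   | inj₂ t≤m = ⊥-elim (ℕ.<-irrefl (ℕ.m≥n⇒m⊓n≡n t≤m) p)

module _ {σ : Signature} {d : ℕ} (types : ∀ r → TypeEnumeration σ d r) where

  ProfileUnion : ∀ {p} → Property σ d p → Set p
  ProfileUnion 𝒫 = ∃[ k ] Σ[ r ∈ (Fin k → ℕ) ] Σ[ ρ ∈ ((j : Fin k) → Profile (types (r j))) ]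
    (Member 𝒫 ≐ ⋃ (Fin k) (λ j → 𝒫⟨_⟩ (types (r j)) (ρ j)))

  -- There are finitely many truncated histograms, every structure fits one of them, and structures
  -- of degree at most `d` fitting the same one agree on `φ`. The profiles taken are those on which
  -- the virtual evaluation of `φ` succeeds.
  definable⇒profiles : ∀ {p} {𝒫 : Property σ d p} → FODefinable 𝒫 → ProfileUnion 𝒫
  definable⇒profiles {𝒫 = 𝒫} (φ , sound , complete) =
    length good , (λ _ → R) , (λ j i → capped t (List.lookup good j i)) , forward , backward
    where
    R t : ℕ
    R = radius φ
    t = threshold d φ

    E : TypeEnumeration σ d R
    E = types R

    Capped : Set
    Capped = Fin (number E) → ℕ

    satisfying? : Decidable (λ (g : Capped) → Eval (multiset E g) empty [] φ)
    satisfying? g = eval? (multiset E g) empty [] φ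

    all good : List Capped
    -- The entries run up to and including `t`, the value that represents all large counts.
    all  = sections (λ _ → upTo (suc t))
    good = filter satisfying? all

    Fits : Structure σ → Capped → Set
    Fits A g = ∀ i → histogram E A i ∈ᴵ capped t (g i)

    fits⇒⇔ : ∀ {A g} → 𝒞 σ d A → Fits A g → A ⊨ φ ⇔ Eval (multiset E g) empty [] φ
    fits⇒⇔ {A} {g} deg fits = sentence⇔eval φ deg (agree-multiset E A deg g λ i → ∈-capped⇒≃ (fits i))

    fitting : ∀ A → Any (Fits A) all
    fitting A = sections-complete _ {Q = λ i k → histogram E A i ∈ᴵ capped t k} λ i →
      lose (∈-upTo⁺ (s≤s (ℕ.m⊓n≤n (histogram E A i) t))) (∈-capped-⊓ t (histogram E A i))

    forward : ∀ {A} → Member 𝒫 A → ⋃ (Fin (length good)) (λ j → 𝒫⟨_⟩ E (λ i → capped t (List.lookup good j i))) A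
    forward {A} m =
      let deg , sat       = sound m
          g , g∈ , fits   = find (fitting A)
          g∈good          = ∈-filter⁺ satisfying? g∈ (to (fits⇒⇔ deg fits) sat)
      in Any.index g∈good , deg , subst (Fits A) (Any.lookup-index g∈good) fits

    backward : ∀ {A} → ⋃ (Fin (length good)) (λ j → 𝒫⟨_⟩ E (λ i → capped t (List.lookup good j i))) A → Member 𝒫 A
    backward (j , deg , fits) =
      complete (deg , from (fits⇒⇔ deg fits) (proj₂ (∈-filter⁻ satisfying? {xs = all} (∈-lookup j))))

-- Formulas for neighbourhood profiles

-- The first `k` entries of the filtered list serve as witnesses, distinct because the list has no
-- repetitions. The converse is the pigeonhole principle.
≤count⇔ : ∀ {n k} {P : Fin n → Set} (P? : Decidable P) →
  k ≤ length (filter P? (allFin n)) ⇔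
  (∃[ ys ] (∀ i j → lookup {n = k} ys i ≡ lookup ys j → i ≡ j) × (∀ j → P (lookup ys j)))
≤count⇔ {n} {k} {P} P? = mk⇔
  (λ k≤ → tabulate (pick k≤) ,
    (λ i j e → inject≤-injective k≤ k≤ i j (AllPairs-lookup sym (filter⁺ P? (allFin⁺ n)) _ _
      (trans (sym (Vec.lookup∘tabulate (pick k≤) i)) (trans e (Vec.lookup∘tabulate (pick k≤) j))))) ,
    λ j → subst P (sym (Vec.lookup∘tabulate (pick k≤) j))
      (proj₂ (∈-filter⁻ P? {xs = allFin n} (∈-lookup (inject≤ j k≤)))))
  (λ (ys , inj , p) → subst (_≤ length (filter P? (allFin n))) (List.length-tabulate {n = k} id)
    (length-≤ (λ j y → lookup ys j ≡ y) (allFin⁺ k) (λ e e′ → inj _ _ (trans e (sym e′)))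
      λ {j} _ → lookup ys j , ∈-filter⁺ P? (∈-allFin _) (p j) , refl))
  where
  pick : k ≤ length (filter P? (allFin n)) → Fin k → Fin n
  pick k≤ j = List.lookup (filter P? (allFin n)) (inject≤ j k≤)

module _ {σ : Signature} where

  -- With no variable in scope there is no atomic sentence, hence the quantifier.
  truth : ∀ {n} → Formula σ n
  truth = univ (equal zero zero)

  ⋀ ⋁ : ∀ {m n} → (Fin m → Formula σ n) → Formula σ n
  ⋀ {zero}  φ = truth
  ⋀ {suc m} φ = conj (φ zero) (⋀ (φ ∘ suc))
  ⋁ {zero}  φ = neg truth
  ⋁ {suc m} φ = disj (φ zero) (⋁ (φ ∘ suc))

  ⋀ᵛ : ∀ {m k n} → (Vec (Fin m) k → Formula σ n) → Formula σ n
  ⋀ᵛ {k = zero}  φ = φ []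
  ⋀ᵛ {k = suc k} φ = ⋀ λ x → ⋀ᵛ λ t → φ (x ∷ t)

  -- Each recursive call adds the new quantifier innermost. In the body the block occupies the
  -- indices `j ↑ˡ n`, and an outer variable `x` becomes `k ↑ʳ x`.
  ∃* : ∀ k {n} → Formula σ (k + n) → Formula σ n
  ∃* zero    φ = φ
  ∃* (suc k) φ = ∃* k (exist φ)

  module _ {n : ℕ} where

    adjacent : Fin n → Fin n → Formula σ n
    adjacent x y = conj (neg (equal x y)) (⋁ λ i → let k = arity σ i in
      ∃* k (conj (atom i (tabulate (_↑ˡ n)))
        (conj (⋁ λ j → equal (k ↑ʳ x) (j ↑ˡ n)) (⋁ λ j → equal (k ↑ʳ y) (j ↑ˡ n)))))

    -- Positions are compared while the formula is built. Having the decision as an argument lets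
    -- correctness be proved by matching on it.
    distinctUnless : ∀ {m} {j k : Fin m} → Dec (j ≡ k) → Fin n → Fin n → Formula σ n
    distinctUnless (yes _) _ _ = truth
    distinctUnless (no _)  x y = neg (equal x y)

    allDistinct : ∀ {m} → (Fin m → Fin n) → Formula σ n
    allDistinct x = ⋀ λ j → ⋀ λ k → distinctUnless (j ≟ k) (x j) (x k)

    literal : Bool → Formula σ n → Formula σ n
    literal true  φ = φ
    literal false φ = neg φ

  within : ∀ {n} → ℕ → Fin n → Fin n → Formula σ n
  within zero    x y = equal x y
  within (suc r) x y = disj (within r x y) (exist (conj (within r (suc x) zero) (adjacent zero (suc y))))

  -- The block variables list the `r`-neighbourhood of `x` along the atomic diagram of `B`. If `B`
  -- is an `r`-ball around `b`, the diagram carries its walks over, which keeps the listed elements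
  -- within distance `r` of `x`.
  copy : ∀ {n} → ℕ → PointedStructure σ → Fin n → Formula σ n
  copy {n} r (B at b) x = ∃* m
    (conj (allDistinct (_↑ˡ n))
    (conj (univ (disj (neg (within r (suc (m ↑ʳ x)) zero)) (⋁ {m} λ j → equal (suc (j ↑ˡ n)) zero)))
    (conj (equal (b ↑ˡ n) (m ↑ʳ x))
          (⋀ λ i → ⋀ᵛ λ t → literal (rel B i t) (atom i (Vec.map (_↑ˡ n) t))))))
    where m = size B

  module _ {A : Structure σ} where

    sat-⋀ : ∀ {m n} {v : Vec (U A) n} (φ : Fin m → Formula σ n) →
      Satisfies A v (⋀ φ) ⇔ (∀ i → Satisfies A v (φ i))
    sat-⋀ {zero}  φ = mk⇔ (λ _ ()) (λ _ _ → refl)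
    sat-⋀ {suc m} φ = mk⇔
      (λ { (p , ps) zero → p ; (p , ps) (suc i) → to (sat-⋀ (φ ∘ suc)) ps i })
      (λ ps → ps zero , from (sat-⋀ (φ ∘ suc)) (ps ∘ suc))

    sat-⋁ : ∀ {m n} {v : Vec (U A) n} (φ : Fin m → Formula σ n) →
      Satisfies A v (⋁ φ) ⇔ (∃[ i ] Satisfies A v (φ i))
    sat-⋁ {zero}  φ = mk⇔ (λ ¬truth → ⊥-elim (¬truth λ _ → refl)) λ ()
    sat-⋁ {suc m} φ = mk⇔
      (λ { (inj₁ p) → zero , p ; (inj₂ q) → let i , p = to (sat-⋁ (φ ∘ suc)) q in suc i , p })
      (λ { (zero , p) → inj₁ p ; (suc i , p) → inj₂ (from (sat-⋁ (φ ∘ suc)) (i , p)) })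

    sat-⋀ᵛ : ∀ {m k n} {v : Vec (U A) n} (φ : Vec (Fin m) k → Formula σ n) →
      Satisfies A v (⋀ᵛ φ) ⇔ (∀ t → Satisfies A v (φ t))
    sat-⋀ᵛ {k = zero}  φ = mk⇔ (λ { p [] → p }) (λ p → p [])
    sat-⋀ᵛ {k = suc k} φ = mk⇔
      (λ { p (x ∷ t) → to (sat-⋀ᵛ λ t → φ (x ∷ t)) (to (sat-⋀ λ x → ⋀ᵛ λ t → φ (x ∷ t)) p x) t })
      (λ p → from (sat-⋀ λ x → ⋀ᵛ λ t → φ (x ∷ t)) λ x → from (sat-⋀ᵛ λ t → φ (x ∷ t)) λ t → p (x ∷ t))

    sat-∃* : ∀ k {n} {v : Vec (U A) n} (φ : Formula σ (k + n)) →
      Satisfies A v (∃* k φ) ⇔ (∃[ ys ] Satisfies A (Vec._++_ {m = k} ys v) φ)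
    sat-∃* zero    φ = mk⇔ ([] ,_) (λ { ([] , p) → p })
    sat-∃* (suc k) φ = mk⇔
      (λ p → let ys , y , q = to (sat-∃* k (exist φ)) p in y ∷ ys , q)
      (λ { (y ∷ ys , q) → from (sat-∃* k (exist φ)) (ys , y , q) })

    module _ {n : ℕ} {v : Vec (U A) n} where

      sat-allDistinct : ∀ {m} (x : Fin m → Fin n) →
        Satisfies A v (allDistinct x) ⇔ (∀ j k → lookup v (x j) ≡ lookup v (x k) → j ≡ k)
      sat-allDistinct x = mk⇔
        (λ p j k → to (one (j ≟ k)) (to (sat-⋀ _) (to (sat-⋀ _) p j) k))
        (λ p → from (sat-⋀ _) λ j → from (sat-⋀ _) λ k → from (one (j ≟ k)) (p j k))
        where
        one : ∀ {j k} (j≟k : Dec (j ≡ k)) →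
          Satisfies A v (distinctUnless j≟k (x j) (x k)) ⇔ (lookup v (x j) ≡ lookup v (x k) → j ≡ k)
        one (yes j≡k) = mk⇔ (λ _ _ → j≡k) (λ _ _ → refl)
        one (no j≢k)  = mk⇔ (λ p e → ⊥-elim (p e)) (λ p e → j≢k (p e))

      sat-literal : ∀ b φ → Satisfies A v (literal b φ) ⇔ (Satisfies A v φ ⇔ T b)
      sat-literal true  φ = mk⇔ (λ p → mk⇔ _ (λ _ → p)) (λ e → from e _)
      sat-literal false φ = mk⇔ (λ ¬p → mk⇔ ¬p ⊥-elim) (λ e → to e)

      lookup-tuple : ∀ {k} (t : Vec (U A) k) → Vec.map (lookup (t Vec.++ v)) (tabulate (_↑ˡ n)) ≡ t
      lookup-tuple t = lookup-ext λ j → trans (Vec.lookup-map j _ (tabulate (_↑ˡ n)))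
        (trans (cong (lookup (t Vec.++ v)) (Vec.lookup∘tabulate (_↑ˡ n) j)) (Vec.lookup-++ˡ t v j))

      sat-∈ : ∀ {k} (t : Vec (U A) k) x →
        Satisfies A (t Vec.++ v) (⋁ λ j → equal (k ↑ʳ x) (j ↑ˡ n)) ⇔ lookup v x ∈ᵛ t
      sat-∈ {k} t x = mk⇔
        (λ p → let j , e = to (sat-⋁ _) p in
          subst (_∈ᵛ t) (trans (sym (Vec.lookup-++ˡ t v j)) (trans (sym e) (Vec.lookup-++ʳ t v x))) (∈ᵛ-lookup j t))
        (λ x∈ → from (sat-⋁ _) (AnyVec.index x∈ , trans (Vec.lookup-++ʳ t v x)
          (trans (AnyVec.lookup-index x∈) (sym (Vec.lookup-++ˡ t v (AnyVec.index x∈))))))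

      sat-adjacent : ∀ x y → Satisfies A v (adjacent x y) ⇔ Adjacent A (lookup v x) (lookup v y)
      sat-adjacent x y = mk⇔
        (λ (x≢y , p) → let i , q = to (sat-⋁ _) p
                           t , h , x∈ , y∈ = to (sat-∃* (arity σ i) _) q
                       in x≢y , i , t , subst (Holds A i) (lookup-tuple t) h , to (sat-∈ t x) x∈ , to (sat-∈ t y) y∈)
        (λ (x≢y , i , t , h , x∈ , y∈) → x≢y , from (sat-⋁ _) (i , from (sat-∃* (arity σ i) _)
          (t , subst (Holds A i) (sym (lookup-tuple t)) h , from (sat-∈ t x) x∈ , from (sat-∈ t y) y∈)))

    sat-within : ∀ r {n} {v : Vec (U A) n} x y →
      Satisfies A v (within r x y) ⇔ Within A r (lookup v x) (lookup v y)
    sat-within zero    x y = mk⇔ id id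
    sat-within (suc r) x y = mk⇔
      (λ { (inj₁ p) → inj₁ (to (sat-within r x y) p)
         ; (inj₂ (a , p , q)) → inj₂ (a , to (sat-within r (suc x) zero) p , to (sat-adjacent zero (suc y)) q) })
      (λ { (inj₁ p) → inj₁ (from (sat-within r x y) p)
         ; (inj₂ (a , p , q)) → inj₂ (a , from (sat-within r (suc x) zero) p , from (sat-adjacent zero (suc y)) q) })

    -- The meaning of the formula `copy` without the bookkeeping of variables, halfway between
    -- satisfaction and `Match`.
    record Copy (r : ℕ) (a : U A) (𝔹 : PointedStructure σ) : Set where
      field
        elements  : Vec (U A) (size (structure 𝔹))
        injective : ∀ j k → lookup elements j ≡ lookup elements k → j ≡ k
        covers    : ∀ x → Within A r a x → ∃[ j ] lookup elements j ≡ x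
        pointed   : lookup elements (point 𝔹) ≡ a
        strong    : ∀ i t → Holds A i (Vec.map (lookup elements) t) ⇔ Holds (structure 𝔹) i t

    -- The listing of the elements is the graph of a match. Conversely, in an `r`-ball every element
    -- is within reach of the centre and hence in the range of the match, so its partners can be
    -- listed as a vector.
    copy⇔match : ∀ {r a 𝔹} → IsBall r 𝔹 → Copy r a 𝔹 ⇔ Match r A (a ∷ []) (structure 𝔹) (point 𝔹 ∷ [])
    copy⇔match {r} {a} {B at b} ball = mk⇔ copy⇒match match⇒copy
      where
      copy⇒match : Copy r a (B at b) → Match r A (a ∷ []) B (b ∷ [])
      copy⇒match C = record
        { Z            = λ x j → lookup elements j ≡ x
        ; isPartialIso = record
          { functional = λ e e′ → injective _ _ (trans e (sym e′))
          ; injective  = λ e e′ → trans (sym e) e′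
          ; preserve   = λ i {s} {t} z h → to (strong i t) (subst (Holds A i) (sym (tuple s t z)) h)
          ; reflect    = λ i {s} {t} z h → subst (Holds A i) (tuple s t z) (from (strong i t) h)
          }
        ; points = λ { zero → pointed }
        ; domain = λ { (zero , w) → covers _ w }
        ; range  = λ {j} _ → lookup elements j , refl
        }
        where
        open Copy C
        tuple : ∀ {k} (s : Vec (U A) k) t → (∀ j → lookup elements (lookup t j) ≡ lookup s j) →
          Vec.map (lookup elements) t ≡ s
        tuple s t z = lookup-ext λ j → trans (Vec.lookup-map j _ t) (z j)

      match⇒copy : Match r A (a ∷ []) B (b ∷ []) → Copy r a (B at b)
      match⇒copy M = record
        { elements  = elements
        ; injective = λ j k e → functional (related j) (subst (λ x → Z x k) (sym e) (related k))
        ; covers    = λ x w → let j , z = domain (zero , w) in j , injective (related j) z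
        ; pointed   = injective (related b) (points zero)
        ; strong    = λ i t → mk⇔ (preserve i (tuple t)) (reflect i (tuple t))
        }
        where
        open Match M
        partner : ∀ j → ∃[ x ] Z x j
        partner j = range (zero , ball j)

        elements : Vec (U A) (size B)
        elements = tabulate (proj₁ ∘ partner)

        related : ∀ j → Z (lookup elements j) j
        related j = subst (λ x → Z x j) (sym (Vec.lookup∘tabulate _ j)) (proj₂ (partner j))

        tuple : ∀ {k} (t : Vec (U B) k) j → Z (lookup (Vec.map (lookup elements) t) j) (lookup t j)
        tuple (x ∷ t) zero    = related x
        tuple (x ∷ t) (suc j) = tuple t j

    sat-copy : ∀ {n r} {v : Vec (U A) n} 𝔹 x → Satisfies A v (copy r 𝔹 x) ⇔ Copy r (lookup v x) 𝔹
    sat-copy {n} {r} {v} (B at b) x = mk⇔ forward backward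
      where
      m = size B

      module _ (ys : Vec (U A) m) where

        tuple : ∀ {k} (t : Vec (Fin m) k) →
          Vec.map (lookup (ys Vec.++ v)) (Vec.map (_↑ˡ n) t) ≡ Vec.map (lookup ys) t
        tuple t = trans (sym (Vec.map-∘ (lookup (ys Vec.++ v)) (_↑ˡ n) t)) (Vec.map-cong (Vec.lookup-++ˡ ys v) t)

        near : ∀ z → Satisfies A (z ∷ ys Vec.++ v) (within r (suc (m ↑ʳ x)) zero) ⇔ Within A r (lookup v x) z
        near z = subst (λ a → Satisfies A (z ∷ ys Vec.++ v) (within r (suc (m ↑ʳ x)) zero) ⇔ Within A r a z)
          (Vec.lookup-++ʳ ys v x) (sat-within r (suc (m ↑ʳ x)) zero)

      forward : Satisfies A v (copy r (B at b) x) → Copy r (lookup v x) (B at b)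
      forward p with ys , inj , cov , pt , str ← to (sat-∃* m _) p = record
        { elements  = ys
        ; injective = λ j k e → to (sat-allDistinct _) inj j k
            (trans (Vec.lookup-++ˡ ys v j) (trans e (sym (Vec.lookup-++ˡ ys v k))))
        ; covers    = λ z w → case cov z of λ
            { (inj₁ ¬w) → ⊥-elim (¬w (from (near ys z) w))
            ; (inj₂ q)  → let j , e = to (sat-⋁ _) q in j , trans (sym (Vec.lookup-++ˡ ys v j)) e }
        ; pointed   = trans (sym (Vec.lookup-++ˡ ys v b)) (trans pt (Vec.lookup-++ʳ ys v x))
        ; strong    = λ i t → subst (λ s → Holds A i s ⇔ Holds B i t) (tuple ys t)
            (to (sat-literal (rel B i t) (atom i _)) (to (sat-⋀ᵛ _) (to (sat-⋀ _) str i) t))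
        }

      backward : Copy r (lookup v x) (B at b) → Satisfies A v (copy r (B at b) x)
      backward C = from (sat-∃* m _) (ys
        , from (sat-allDistinct _) (λ j k e → injective j k
            (trans (sym (Vec.lookup-++ˡ ys v j)) (trans e (Vec.lookup-++ˡ ys v k))))
        -- The implication is written as a disjunction, so a decision is required to choose the
        -- disjunct.
        , (λ z → case within? A r (lookup v x) z of λ
            { (yes w) → inj₂ (let j , e = covers z w in from (sat-⋁ _) (j , trans (Vec.lookup-++ˡ ys v j) e))
            ; (no ¬w) → inj₁ (¬w ∘ to (near ys z)) })
        , trans (Vec.lookup-++ˡ ys v b) (trans pointed (sym (Vec.lookup-++ʳ ys v x)))
        , from (sat-⋀ _) λ i → from (sat-⋀ᵛ _) λ t → from (sat-literal (rel B i t) (atom i _))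
            (subst (λ s → Holds A i s ⇔ Holds B i t) (sym (tuple ys t)) (strong i t)))
        where open Copy C renaming (elements to ys)

module _ {σ : Signature} {d r : ℕ} (E : TypeEnumeration σ d r) where

  atLeast : ℕ → Fin (number E) → Sentence σ
  atLeast k i = ∃* k (conj (allDistinct (_↑ˡ 0)) (⋀ λ j → copy r (τ E i) (j ↑ˡ 0)))

  sat-hasType : ∀ {A n} {v : Vec (U A) n} i x → Satisfies A v (copy r (τ E i) x) ⇔ HasType E A i (lookup v x)
  sat-hasType i x =
    mk⇔ (match⇒hasType E) (hasType⇒match E) ⇔-∘ (copy⇔match (isBall E i) ⇔-∘ sat-copy (τ E i) x)

  sat-atLeast : ∀ {A} k i → A ⊨ atLeast k i ⇔ k ≤ histogram E A i
  sat-atLeast {A} k i = mk⇔ forward backward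
    where
    module _ (ys : Vec (U A) k) where
      v = ys Vec.++ []

      sat-type : ∀ j → Satisfies A v (copy r (τ E i) (j ↑ˡ 0)) ⇔ HasType E A i (lookup ys j)
      sat-type j = subst (λ y → Satisfies A v (copy r (τ E i) (j ↑ˡ 0)) ⇔ HasType E A i y)
        (Vec.lookup-++ˡ ys [] j) (sat-hasType i (j ↑ˡ 0))

      lookup-≡ : ∀ j l → lookup v (j ↑ˡ 0) ≡ lookup v (l ↑ˡ 0) ⇔ lookup ys j ≡ lookup ys l
      lookup-≡ j l = subst₂ (λ y z → lookup v (j ↑ˡ 0) ≡ lookup v (l ↑ˡ 0) ⇔ y ≡ z)
        (Vec.lookup-++ˡ ys [] j) (Vec.lookup-++ˡ ys [] l) (mk⇔ id id)

    forward : A ⊨ atLeast k i → k ≤ histogram E A i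
    forward p with ys , inj , types ← to (sat-∃* k _) p = from (≤count⇔ (hasType? E A i))
      ( ys
      , (λ j l e → to (sat-allDistinct _) inj j l (from (lookup-≡ ys j l) e))
      , (λ j → to (sat-type ys j) (to (sat-⋀ _) types j)) )

    backward : k ≤ histogram E A i → A ⊨ atLeast k i
    backward k≤ with ys , inj , types ← to (≤count⇔ (hasType? E A i)) k≤ = from (sat-∃* k _)
      ( ys
      , from (sat-allDistinct _) (λ j l e → inj j l (to (lookup-≡ ys j l) e))
      , from (sat-⋀ _) (λ j → from (sat-type ys j) (types j)) )

  inInterval : Interval → Fin (number E) → Sentence σ
  inInterval [ k , l ]⟨ _ ⟩ i = conj (atLeast k i) (neg (atLeast (suc l) i))
  inInterval [ k ,∞⟩        i = atLeast k i

  sat-inInterval : ∀ {A} I i → A ⊨ inInterval I i ⇔ histogram E A i ∈ᴵ I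
  sat-inInterval {A} [ k , l ]⟨ _ ⟩ i = sat-atLeast k i ×-⇔ mk⇔
    (λ ¬p → ℕ.≮⇒≥ (¬p ∘ from (sat-atLeast (suc l) i)))
    (λ h≤l p → ℕ.<⇒≱ (to (sat-atLeast (suc l) i) p) h≤l)
  sat-inInterval [ k ,∞⟩ i = sat-atLeast k i

-- From unions of profiles to sentences

module _ {σ : Signature} {d : ℕ} (types : ∀ r → TypeEnumeration σ d r) where

  -- As there are finitely many types, a profile is a finite conjunction of interval constraints.
  -- The degree bound is passed along unchanged, since definability is relative to `𝒞 σ d`.
  profiles⇒definable : ∀ {p} {𝒫 : Property σ d p} → ProfileUnion types 𝒫 → FODefinable 𝒫
  profiles⇒definable (k , r , ρ , sound , complete) =
    φ ,
    (λ m → let j , deg , h = sound m in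
      deg , from (sat-⋁ _) (j , from (sat-⋀ _) λ i → from (sat-inInterval (types (r j)) (ρ j i) i) (h i))) ,
    λ (deg , p) → let j , q = to (sat-⋁ _) p in
      complete (j , deg , λ i → to (sat-inInterval (types (r j)) (ρ j i) i) (to (sat-⋀ _) q i))
    where
    φ : Sentence σ
    φ = ⋁ λ j → ⋀ λ i → inInterval (types (r j)) (ρ j i) i

lemma3p2 : {p : Level} (σ : Signature) (d : ℕ)
    (types : (r : ℕ) → TypeEnumeration σ d r) (𝒫 : Property σ d p) →
    Satisfiable (Member 𝒫) →
    FODefinable 𝒫 ⇔
    (∃[ k ] Σ[ r ∈ (Fin k → ℕ) ] Σ[ ρ ∈ ((j : Fin k) → Profile (types (r j))) ]
    (Member 𝒫 ≐ ⋃ (Fin k) (λ j → 𝒫⟨_⟩ (types (r j)) (ρ j))))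
lemma3p2 σ d types 𝒫 _ = mk⇔ (definable⇒profiles types {𝒫 = 𝒫}) (profiles⇒definable types {𝒫 = 𝒫})
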